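{- Let $G$ be a weakly connected oriented graph on $n\ge 2$ vertices with non-zero edge weights in $\mathbb{C}\setminus\mathbb{R}^-$ and complex signless incidence matrix $N$, and let $N^+$ be the Moore--Penrose inverse of $N$. (a) If $G$ has at least one even cycle $C$ such that $wt(C)\in\mathbb{C}\setminus\mathbb{R}^+$ or at least one odd cycle $C$ such that $wt(C)\in\mathbb{C}\setminus\mathbb{R}^-$, then $NN^+=I_n$. (b) If $G$ is an oriented tree, or all of its even cycles have positive real weights and all of its odd cycles have negative real weights, then $$NN^+=I_n-\frac1n S,$$ where $S$ is the signed equiweight matrix of $G$.
   Context: An oriented graph $G$ is obtained from a finite simple undirected graph $G_u$ (its underlying graph) by giving each edge exactly one direction; it is weakly connected if $G_u$ is connected, and it is an oriented tree if $G_u$ is a tree. Write $V(G)=\{1,\dots,n\}$ and $E(G)=\{e_1,\dots,e_m\}$. Each directed edge $(u,v)$ (from $u$ to $v$) has a non-zero complex weight $w_{uv}$. $\mathbb{R}^+$ and $\mathbb{R}^-$ denote the positive and the negative real numbers, and $\sqrt{\cdot}$ is the principal square root. The complex signless incidence matrix of $G$ is the $n\times m$ matrix $N=(n_{ij})$ where, for $e_j=(u,v)$, $n_{ij}=\sqrt{w_{uv}}$ if $i=u$, $n_{ij}=\sqrt{\overline{w_{uv}}}$ if $i=v$, and $n_{ij}=0$ otherwise. Put $a_{ij}=w_{ij}$ if $(i,j)\in E(G)$, $a_{ij}=\overline{w_{ji}}$ if $(j,i)\in E(G)$, and $a_{ij}=0$ otherwise. The weight of a walk $\gamma=(i_1,\dots,i_k)$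 in $G_u$ is $wt(\gamma)=\prod_{s=1}^{k-1}a_{i_si_{s+1}}$ (so a trivial one-vertex walk has weight $1$). A cycle of $G$ means a cycle of $G_u$; $wt(C)$ is the weight of the closed walk going once around $C$ in either direction (the two directions give complex conjugate values, so the conditions above do not depend on the choice). Signed equiweight matrix: when $G$ is an oriented tree or all its even cycles have positive and all its odd cycles have negative weights, $S=(s_{ij})$ is the $n\times n$ matrix with $$s_{ij}=(-1)^{d(i,j)}\frac{wt(\gamma_{i-j})}{|wt(\gamma_{i-j})|},$$ where $d(i,j)$ is the distance between $i$ and $j$ in $G_u$ and $\gamma_{i-j}$ is any shortest walk from $i$ to $j$ in $G_u$; under the stated condition the value does not depend on the choice of shortest walk. -}

module Defs where

open import Data.Nat using (ℕ; zero; suc; _≤_; _⊔_; NonZero)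
open import Data.Nat.Properties using (≤-trans; ≤-refl; m≤m⊔n; m≤n⊔m)
open import Data.Nat.Divisibility using (_∣_)
open import Data.Integer using (+_)
open import Data.Rational as ℚ using (ℚ; 0ℚ; 1ℚ; ½)
import Data.Rational.Properties as ℚₚ
open import Algebra.Bundles using (module CommutativeMonoid)
import Algebra.Properties.CommutativeSemigroup as CommutativeSemigroupProperties
open import Data.Fin using (Fin; _≟_)
open import Data.Fin.Properties using (any?)
open import Data.List using (List; []; _∷_)
open import Data.List.Relation.Unary.Unique.Propositional using (Unique)
open import Data.Product using (Σ; ∃-syntax; _×_; _,_)
open import Data.Sum using (_⊎_)
import Data.Vec.Functional as Vector
open import Relation.Nullary using (¬_; yes; no; _×-dec_)
open import Relation.Binary.PropositionalEquality using (_≡_; _≢_; refl; sym; trans; cong; cong₂; subst; subst₂)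

open CommutativeSemigroupProperties (CommutativeMonoid.commutativeSemigroup ℚₚ.+-0-commutativeMonoid) using (interchange)

-- Real numbers: Cauchy sequences of rationals, with equality as a setoid
-- relation.

IsCauchy : (ℕ → ℚ) → Set
IsCauchy x = ∀ ε → 0ℚ ℚ.< ε → ∃[ K ] (∀ m n → K ≤ m → K ≤ n → ℚ.∣ x m ℚ.- x n ∣ ℚ.< ε)

record ℝ : Set where
  constructor mkℝ
  field
    seq    : ℕ → ℚ
    cauchy : IsCauchy seq

open ℝ public

abstract
  half-pos : ∀ {ε} → 0ℚ ℚ.< ε → 0ℚ ℚ.< ½ ℚ.* ε
  half-pos {ε} 0<ε = ℚₚ.positive⁻¹ _ {{ℚₚ.pos*pos⇒pos ½ ε {{ℚ.positive 0<ε}}}}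

  half+half : ∀ ε → ½ ℚ.* ε ℚ.+ ½ ℚ.* ε ≡ ε
  half+half ε = trans (sym (ℚₚ.*-distribʳ-+ ε ½ ½)) (ℚₚ.*-identityˡ ε)

  cauchy-const : ∀ q → IsCauchy (λ _ → q)
  cauchy-const q ε 0<ε =
    0 , λ _ _ _ _ → subst (λ t → ℚ.∣ t ∣ ℚ.< ε) (sym (ℚₚ.+-inverseʳ q)) 0<ε

  cauchy-neg : ∀ {x} → IsCauchy x → IsCauchy (λ k → ℚ.- x k)
  cauchy-neg {x} cx ε 0<ε with cx ε 0<ε
  ... | K , h = K , λ m n K≤m K≤n →
    subst (ℚ._< ε)
      (trans (sym (ℚₚ.∣-p∣≡∣p∣ (x m ℚ.- x n))) (cong ℚ.∣_∣ (ℚₚ.neg-distrib-+ (x m) (ℚ.- x n))))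
      (h m n K≤m K≤n)

  cauchy-+ : ∀ {x y} → IsCauchy x → IsCauchy y → IsCauchy (λ k → x k ℚ.+ y k)
  cauchy-+ {x} {y} cx cy ε 0<ε with cx (½ ℚ.* ε) (half-pos 0<ε) | cy (½ ℚ.* ε) (half-pos 0<ε)
  ... | K , h | L , h′ = K ⊔ L , λ m n p q →
    subst₂ ℚ._<_ (cong ℚ.∣_∣ (rearrange (x m) (x n) (y m) (y n))) (half+half ε)
      (ℚₚ.≤-<-trans (ℚₚ.∣p+q∣≤∣p∣+∣q∣ (x m ℚ.- x n) (y m ℚ.- y n))
        (ℚₚ.+-mono-< (h m n (≤-trans (m≤m⊔n K L) p) (≤-trans (m≤m⊔n K L) q))
                     (h′ m n (≤-trans (m≤n⊔m K L) p) (≤-trans (m≤n⊔m K L) q))))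
    where
    rearrange : ∀ a b c d → (a ℚ.- b) ℚ.+ (c ℚ.- d) ≡ (a ℚ.+ c) ℚ.- (b ℚ.+ d)
    rearrange a b c d = trans (interchange a (ℚ.- b) c (ℚ.- d))
      (cong ((a ℚ.+ c) ℚ.+_) (sym (ℚₚ.neg-distrib-+ b d)))

  eventually-bounded : ∀ {x} → IsCauchy x →
    ∃[ B ] (0ℚ ℚ.< B × ∃[ K ] (∀ n → K ≤ n → ℚ.∣ x n ∣ ℚ.< B))
  eventually-bounded {x} cx with cx 1ℚ (ℚₚ.positive⁻¹ 1ℚ)
  ... | K , h = ℚ.∣ x K ∣ ℚ.+ 1ℚ
    , ℚₚ.+-mono-≤-< (ℚₚ.0≤∣p∣ (x K)) (ℚₚ.positive⁻¹ 1ℚ)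
    , K , λ n K≤n →
      subst (λ t → ℚ.∣ t ∣ ℚ.< ℚ.∣ x K ∣ ℚ.+ 1ℚ) (telescope (x K) (x n))
        (ℚₚ.≤-<-trans (ℚₚ.∣p+q∣≤∣p∣+∣q∣ (x K) (x n ℚ.- x K))
          (ℚₚ.+-mono-≤-< (ℚₚ.≤-refl {ℚ.∣ x K ∣}) (h n K K≤n ≤-refl)))
    where
    telescope : ∀ a b → a ℚ.+ (b ℚ.- a) ≡ b
    telescope a b = trans (ℚₚ.+-comm a (b ℚ.- a)) (trans (ℚₚ.+-assoc b (ℚ.- a) a)
      (trans (cong (b ℚ.+_) (ℚₚ.+-inverseˡ a)) (ℚₚ.+-identityʳ b)))

  scale : ∀ {B ε} → 0ℚ ℚ.< B → 0ℚ ℚ.< ε → ∃[ δ ] (0ℚ ℚ.< δ × B ℚ.* δ ≡ ε)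
  scale {B} {ε} 0<B 0<ε = ℚ.1/ B ℚ.* ε
    , ℚₚ.positive⁻¹ _ {{ℚₚ.pos*pos⇒pos (ℚ.1/ B) {{ℚₚ.1/pos⇒pos B}} ε}}
    , trans (sym (ℚₚ.*-assoc B (ℚ.1/ B) ε))
        (trans (cong (ℚ._* ε) (ℚₚ.*-inverseʳ B)) (ℚₚ.*-identityˡ ε))
    where
    instance
      B-pos : ℚ.Positive B
      B-pos = ℚ.positive 0<B
      ε-pos : ℚ.Positive ε
      ε-pos = ℚ.positive 0<ε
      B-nonZero : ℚ.NonZero B
      B-nonZero = ℚₚ.pos⇒nonZero B

  abs-product-< : ∀ {a b B δ} → 0ℚ ℚ.< B → ℚ.∣ a ∣ ℚ.< B → ℚ.∣ b ∣ ℚ.< δ → ℚ.∣ a ℚ.* b ∣ ℚ.< B ℚ.* δ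
  abs-product-< {a} {b} {B} {δ} 0<B a<B b<δ =
    subst (ℚ._< B ℚ.* δ) (sym (ℚₚ.∣p*q∣≡∣p∣*∣q∣ a b))
      (ℚₚ.≤-<-trans
        (ℚₚ.*-monoʳ-≤-nonNeg ℚ.∣ b ∣ {{ℚ.nonNegative (ℚₚ.0≤∣p∣ b)}} (ℚₚ.<⇒≤ a<B))
        (ℚₚ.*-monoʳ-<-pos B {{ℚ.positive 0<B}} b<δ))

  cauchy-* : ∀ {x y} → IsCauchy x → IsCauchy y → IsCauchy (λ k → x k ℚ.* y k)
  cauchy-* {x} {y} cx cy ε 0<ε
    with eventually-bounded {x} cx | eventually-bounded {y} cy
  ... | B , 0<B , K₁ , x<B | C , 0<C , K₂ , y<C
    with scale 0<B (half-pos 0<ε) | scale 0<C (half-pos 0<ε)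
  ... | δ , 0<δ , Bδ | η , 0<η , Cη
    with cy δ 0<δ | cx η 0<η
  ... | K₃ , hy | K₄ , hx = (K₁ ⊔ K₂) ⊔ (K₃ ⊔ K₄) , λ m n p q →
    subst₂ ℚ._<_ (cong ℚ.∣_∣ (rearrange (x m) (x n) (y m) (y n))) (half+half ε)
      (ℚₚ.≤-<-trans (ℚₚ.∣p+q∣≤∣p∣+∣q∣ (x m ℚ.* (y m ℚ.- y n)) (y n ℚ.* (x m ℚ.- x n)))
        (ℚₚ.+-mono-<
          (subst (ℚ.∣ x m ℚ.* (y m ℚ.- y n) ∣ ℚ.<_) Bδ
            (abs-product-< {x m} 0<B (x<B m (≤-trans K₁≤ p)) (hy m n (≤-trans K₃≤ p) (≤-trans K₃≤ q))))
          (subst (ℚ.∣ y n ℚ.* (x m ℚ.- x n) ∣ ℚ.<_) Cη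
            (abs-product-< {y n} 0<C (y<C n (≤-trans K₂≤ q)) (hx m n (≤-trans K₄≤ p) (≤-trans K₄≤ q))))))
    where
    K₁≤ : K₁ ≤ (K₁ ⊔ K₂) ⊔ (K₃ ⊔ K₄)
    K₁≤ = ≤-trans (m≤m⊔n K₁ K₂) (m≤m⊔n (K₁ ⊔ K₂) (K₃ ⊔ K₄))
    K₂≤ : K₂ ≤ (K₁ ⊔ K₂) ⊔ (K₃ ⊔ K₄)
    K₂≤ = ≤-trans (m≤n⊔m K₁ K₂) (m≤m⊔n (K₁ ⊔ K₂) (K₃ ⊔ K₄))
    K₃≤ : K₃ ≤ (K₁ ⊔ K₂) ⊔ (K₃ ⊔ K₄)
    K₃≤ = ≤-trans (m≤m⊔n K₃ K₄) (m≤n⊔m (K₁ ⊔ K₂) (K₃ ⊔ K₄))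
    K₄≤ : K₄ ≤ (K₁ ⊔ K₂) ⊔ (K₃ ⊔ K₄)
    K₄≤ = ≤-trans (m≤n⊔m K₃ K₄) (m≤n⊔m (K₁ ⊔ K₂) (K₃ ⊔ K₄))
    cancel : ∀ p q r → (p ℚ.- q) ℚ.+ (q ℚ.- r) ≡ p ℚ.- r
    cancel p q r = trans (ℚₚ.+-assoc p (ℚ.- q) (q ℚ.- r))
      (cong (p ℚ.+_) (trans (sym (ℚₚ.+-assoc (ℚ.- q) q (ℚ.- r)))
        (trans (cong (ℚ._- r) (ℚₚ.+-inverseˡ q)) (ℚₚ.+-identityˡ (ℚ.- r)))))
    distrib : ∀ p q r → p ℚ.* (q ℚ.- r) ≡ p ℚ.* q ℚ.- p ℚ.* r
    distrib p q r = trans (ℚₚ.*-distribˡ-+ p q (ℚ.- r))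
      (cong (p ℚ.* q ℚ.+_) (sym (ℚₚ.neg-distribʳ-* p r)))
    rearrange : ∀ a b c d →
      a ℚ.* (c ℚ.- d) ℚ.+ d ℚ.* (a ℚ.- b) ≡ a ℚ.* c ℚ.- b ℚ.* d
    rearrange a b c d =
      trans (cong₂ ℚ._+_ (distrib a c d)
        (trans (distrib d a b) (cong₂ ℚ._-_ (ℚₚ.*-comm d a) (ℚₚ.*-comm d b))))
        (cancel (a ℚ.* c) (a ℚ.* d) (b ℚ.* d))

fromℚ : ℚ → ℝ
fromℚ q = mkℝ (λ _ → q) (cauchy-const q)

0ᴿ 1ᴿ : ℝ
0ᴿ = fromℚ 0ℚ
1ᴿ = fromℚ 1ℚ

infix  4 _≈ᴿ_ _<ᴿ_ _≤ᴿ_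
infixl 6 _+ᴿ_ _-ᴿ_
infixl 7 _*ᴿ_
infix  8 -ᴿ_

_+ᴿ_ _*ᴿ_ : ℝ → ℝ → ℝ
x +ᴿ y = mkℝ (λ k → seq x k ℚ.+ seq y k) (cauchy-+ {seq x} {seq y} (cauchy x) (cauchy y))
x *ᴿ y = mkℝ (λ k → seq x k ℚ.* seq y k) (cauchy-* {seq x} {seq y} (cauchy x) (cauchy y))

-ᴿ_ : ℝ → ℝ
-ᴿ x = mkℝ (λ k → ℚ.- seq x k) (cauchy-neg {seq x} (cauchy x))

_-ᴿ_ : ℝ → ℝ → ℝ
x -ᴿ y = x +ᴿ (-ᴿ y)

_≈ᴿ_ _<ᴿ_ _≤ᴿ_ : ℝ → ℝ → Set
x ≈ᴿ y = ∀ ε → 0ℚ ℚ.< ε → ∃[ K ] (∀ n → K ≤ n → ℚ.∣ seq x n ℚ.- seq y n ∣ ℚ.< ε)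
x <ᴿ y = ∃[ ε ] (0ℚ ℚ.< ε × ∃[ K ] (∀ n → K ≤ n → seq x n ℚ.+ ε ℚ.< seq y n))
x ≤ᴿ y = ¬ (y <ᴿ x)

record ℂ : Set where
  constructor _+i_
  field
    Re : ℝ
    Im : ℝ

open ℂ public

infix  4 _≈_
infixl 6 _+_ _-_
infixl 7 _*_
infix  8 -_
infixr 9 _^_

_≈_ : ℂ → ℂ → Set
z ≈ w = (Re z ≈ᴿ Re w) × (Im z ≈ᴿ Im w)

real : ℝ → ℂ
real x = x +i 0ᴿ

0ℂ 1ℂ : ℂ
0ℂ = real 0ᴿ
1ℂ = real 1ᴿ

_+_ _*_ : ℂ → ℂ → ℂ
z + w = (Re z +ᴿ Re w) +i (Im z +ᴿ Im w)
z * w = (Re z *ᴿ Re w -ᴿ Im z *ᴿ Im w) +i (Re z *ᴿ Im w +ᴿ Im z *ᴿ Re w)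

-_ conj : ℂ → ℂ
- z = (-ᴿ Re z) +i (-ᴿ Im z)
conj z = Re z +i (-ᴿ Im z)

_-_ : ℂ → ℂ → ℂ
z - w = z + (- w)

_^_ : ℂ → ℕ → ℂ
z ^ zero  = 1ℂ
z ^ suc k = z * z ^ k

reciprocal : (n : ℕ) .{{_ : NonZero n}} → ℂ
reciprocal n = real (fromℚ ((+ 1) ℚ./ n))

_∈ℝ⁺ _∈ℝ⁻ : ℂ → Set
z ∈ℝ⁺ = (Im z ≈ᴿ 0ᴿ) × (0ᴿ <ᴿ Re z)
z ∈ℝ⁻ = (Im z ≈ᴿ 0ᴿ) × (Re z <ᴿ 0ᴿ)

-- Square roots, moduli and quotients are given by their defining properties
-- rather than as functions: without excluded middle the principal square root
-- and division by a number merely known to be ≉ 0 are not total functions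
-- here.  Classically each relation determines its last argument up to equality.

-- s = √z
IsPrincipalSqrt : ℂ → ℂ → Set
IsPrincipalSqrt z s =
  (s * s ≈ z) × ((0ᴿ <ᴿ Re s) ⊎ ((Re s ≈ᴿ 0ᴿ) × (0ᴿ ≤ᴿ Im s)))

-- r = |z|
IsModulus : ℂ → ℝ → Set
IsModulus z r = (0ᴿ ≤ᴿ r) × (r *ᴿ r ≈ᴿ Re z *ᴿ Re z +ᴿ Im z *ᴿ Im z)

-- q = z / w; the clause on w excludes division by zero.
IsQuotient : ℂ → ℂ → ℂ → Set
IsQuotient z w q = ¬ (w ≈ 0ℂ) × (q * w ≈ z)

Matrix : ℕ → ℕ → Set
Matrix m n = Fin m → Fin n → ℂ

infix  4 _≈ᴹ_
infixl 6 _-ᴹ_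
infixl 7 _*ᴹ_ _·ᴹ_
infix  9 _ᴴ

_≈ᴹ_ : ∀ {m n} → Matrix m n → Matrix m n → Set
A ≈ᴹ B = ∀ i j → A i j ≈ B i j

∑ : ∀ {n} → (Fin n → ℂ) → ℂ
∑ = Vector.foldr _+_ 0ℂ

_*ᴹ_ : ∀ {m n p} → Matrix m n → Matrix n p → Matrix m p
(A *ᴹ B) i k = ∑ (λ j → A i j * B j k)

_-ᴹ_ : ∀ {m n} → Matrix m n → Matrix m n → Matrix m n
(A -ᴹ B) i j = A i j - B i j

_·ᴹ_ : ∀ {m n} → ℂ → Matrix m n → Matrix m n
(c ·ᴹ A) i j = c * A i j

_ᴴ : ∀ {m n} → Matrix m n → Matrix n m
(A ᴴ) i j = conj (A j i)

identity : ∀ n → Matrix n n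
identity n i j with i ≟ j
... | yes _ = 1ℂ
... | no  _ = 0ℂ

-- The four Penrose equations, which determine X uniquely.
record IsMoorePenroseInverse {m n} (A : Matrix m n) (X : Matrix n m) : Set where
  field
    AXA≈A : A *ᴹ X *ᴹ A ≈ᴹ A
    XAX≈X : X *ᴹ A *ᴹ X ≈ᴹ X
    AX-hermitian : (A *ᴹ X) ᴴ ≈ᴹ A *ᴹ X
    XA-hermitian : (X *ᴹ A) ᴴ ≈ᴹ X *ᴹ A

record OrientedGraph (n : ℕ) : Set where
  field
    m       : ℕ
    src tgt : Fin m → Fin n
    loopless        : ∀ e → src e ≢ tgt e
    no-parallel     : ∀ e f → src e ≡ src f → tgt e ≡ tgt f → e ≡ f
    no-antiparallel : ∀ e f → src e ≡ tgt f → tgt e ≢ src f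
    weight          : Fin m → ℂ
    weight≉0        : ∀ e → ¬ (weight e ≈ 0ℂ)

module _ {n : ℕ} (G : OrientedGraph n) where
  open OrientedGraph G

  IsEdge : Fin n → Fin n → Fin m → Set
  IsEdge i j e = (src e ≡ i) × (tgt e ≡ j)

  -- Adjacency in the underlying undirected graph
  Adjacent : Fin n → Fin n → Set
  Adjacent i j = ∃[ e ] (IsEdge i j e ⊎ IsEdge j i e)

  -- The number a_{ij}
  entry : Fin n → Fin n → ℂ
  entry i j with any? (λ e → (src e ≟ i) ×-dec (tgt e ≟ j))
  ... | yes (e , _) = weight e
  ... | no  _ with any? (λ e → (src e ≟ j) ×-dec (tgt e ≟ i))
  ...   | yes (e , _) = conj (weight e)
  ...   | no  _       = 0ℂ

  data Walk : Fin n → Fin n → Set where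
    []  : ∀ {i} → Walk i i
    _∷_ : ∀ {i j k} → Adjacent i j → Walk j k → Walk i k

  length : ∀ {i j} → Walk i j → ℕ
  length []      = 0
  length (_ ∷ γ) = suc (length γ)

  wt : ∀ {i j} → Walk i j → ℂ
  wt []                  = 1ℂ
  wt (_∷_ {i} {j} _ γ) = entry i j * wt γ

  -- All vertices of a walk except its last one
  vertices : ∀ {i j} → Walk i j → List (Fin n)
  vertices []          = []
  vertices (_∷_ {i} _ γ) = i ∷ vertices γ

  WeaklyConnected : Set
  WeaklyConnected = ∀ i j → Walk i j

  IsCycle : ∀ {i} → Walk i i → Set
  IsCycle γ = (3 ≤ length γ) × Unique (vertices γ)

  IsEvenCycle IsOddCycle : ∀ {i} → Walk i i → Set
  IsEvenCycle γ = IsCycle γ × (2 ∣ length γ)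
  IsOddCycle  γ = IsCycle γ × ¬ (2 ∣ length γ)

  IsOrientedTree : Set
  IsOrientedTree = WeaklyConnected × (∀ {i} (γ : Walk i i) → ¬ IsCycle γ)

  IsDistance : Fin n → Fin n → ℕ → Set
  IsDistance i j d = (Σ (Walk i j) λ γ → length γ ≡ d) × (∀ (γ : Walk i j) → d ≤ length γ)

  record IsSignlessIncidence (N : Matrix n m) : Set where
    field
      at-src    : ∀ e → IsPrincipalSqrt (weight e) (N (src e) e)
      at-tgt    : ∀ e → IsPrincipalSqrt (conj (weight e)) (N (tgt e) e)
      elsewhere : ∀ i e → i ≢ src e → i ≢ tgt e → N i e ≈ 0ℂ

  -- Each entry may be computed from a shortest walk of its own choosing.
  IsSignedEquiweight : Matrix n n → Set
  IsSignedEquiweight S = ∀ i j →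
    ∃[ d ] Σ (Walk i j) λ γ → ∃[ r ]
      (IsDistance i j d × length γ ≡ d × IsModulus (wt γ) r ×
       IsQuotient ((- 1ℂ) ^ d * wt γ) (real r) (S i j))

{-# OPTIONS --safe #-}
module Submission where

-- Put P = N N⁺ and Q = I - P.  Then Q is Hermitian with Q N = 0, so for a row q
-- of Q and an edge (u,v) of weight w = s² the column of N at that edge reads
-- q_u s + q_v s̄ = 0, i.e. q_v ∣w∣ = - q_u w.  Multiplying along a walk γ from i
-- to j gives q_j ∣wt γ∣ = (-1)^{length γ} q_i wt γ.
--
-- (a) On a closed walk C with (-1)^{length C} wt C ≠ ∣wt C∣ this forces q_i = 0,
-- and then q = 0 by connectedness, so P = I.
--
-- (b) If all cycles satisfy (-1)^{length C} wt C = ∣wt C∣, so do all closed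
-- walks; hence each row S_i of S satisfies S_i N = 0, so S_i Q = S_i.  As
-- Q_ij = Q_ii S_ij, Q is Hermitian and ∣S_ij∣ = 1, the i-th coordinate of
-- S_i Q = S_i says n Q_ii = 1.
--
-- Equality of Cauchy reals is stable under double negation, which makes ℂ an
-- integral domain in the strong form "z w ≈ 0 and w ≉ 0 imply z ≈ 0"; all
-- divisions are replaced by cancellation.

open import Defs using (OrientedGraph; Walk; Adjacent; length; vertices; []; _∷_; IsCycle; WeaklyConnected)
open import Level using (0ℓ)
open import Function using (_∘_)
open import Data.Empty using (⊥-elim)
open import Data.Product using (Σ; ∃-syntax; _×_; _,_; proj₁; proj₂)
open import Data.Sum using (_⊎_; inj₁; inj₂)
open import Data.Nat using (ℕ; zero; suc; NonZero; _≤_; _<_; _⊔_; z≤n; s≤s)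
import Data.Nat as ℕ
import Data.Nat.Properties as ℕₚ
open import Data.Nat.Coprimality as Coprimality using (1-coprimeTo)
open import Data.Nat.Divisibility using (_∣_; _∣0; ∣-refl; ∣m∣n⇒∣m+n; ∣m+n∣m⇒∣n; ∣1⇒≡1; _∣?_)
open import Data.Integer as ℤ using (+_)
import Data.Integer.Properties as ℤₚ
open import Data.Rational as ℚ using (ℚ; 0ℚ; 1ℚ; ½)
import Data.Rational.Properties as ℚₚ
open import Data.Rational.Solver using (module +-*-Solver)
open import Data.Fin using (Fin; _≟_; punchIn; punchOut)
open import Data.Fin.Properties using (any?; punchInᵢ≢i; punchIn-punchOut; punchIn-injective)
open import Data.List.Membership.Propositional using (_∈_)
open import Data.List.Membership.DecPropositional using (_∈?_)
open import Data.List.Relation.Unary.Any using (here; there)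
open import Data.List.Relation.Unary.All.Properties using (¬Any⇒All¬)
open import Data.List.Relation.Unary.Unique.Propositional using (Unique; []; _∷_)
import Data.Vec.Functional as Vector
open import Relation.Nullary using (¬_; Dec; yes; no; contradiction; _×-dec_)
import Relation.Binary.PropositionalEquality as ≡
open ≡ using (_≡_; _≢_)
import Relation.Binary.Reasoning.Setoid as SetoidReasoning
open import Algebra.Bundles using (CommutativeRing)
import Algebra.Properties.Ring as RingProperties
import Algebra.Properties.CommutativeMonoid.Sum as MonoidSum
import Algebra.Properties.Semiring.Sum as SemiringSum
import Algebra.Properties.Semiring.Mult as SemiringMult
import Algebra.Solver.Ring.NaturalCoefficients.Default as SemiringSolver

-- Decomposition of closed walks

module Walks {n} (G : OrientedGraph n) where

  infixr 5 _++_

  _++_ : ∀ {i j k} → Walk G i j → Walk G j k → Walk G i k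
  []      ++ δ = δ
  (A ∷ γ) ++ δ = A ∷ (γ ++ δ)

  length-++ : ∀ {i j k} (γ : Walk G i j) (δ : Walk G j k) →
    length G (γ ++ δ) ≡ length G γ ℕ.+ length G δ
  length-++ []      δ = ≡.refl
  length-++ (A ∷ γ) δ = ≡.cong suc (length-++ γ δ)

  split-at : ∀ {i j k} (γ : Walk G i j) → k ∈ vertices G γ →
    Σ (Walk G i k) λ β → Σ (Walk G k j) λ δ → (γ ≡ β ++ δ) × (0 < length G δ)
  split-at (A ∷ γ) (here ≡.refl) = [] , A ∷ γ , ≡.refl , s≤s z≤n
  split-at (A ∷ γ) (there k∈) with split-at γ k∈
  ... | β , δ , ≡.refl , 0<δ = A ∷ β , δ , ≡.refl , 0<δ

  -- The final vertex is not listed in vertices, so δ is nonempty as well.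
  ProperLoop : ∀ {i j} → Walk G i j → Set
  ProperLoop {i} {j} γ = ∃[ k ] Σ (Walk G i k) λ α → Σ (Walk G k k) λ β → Σ (Walk G k j) λ δ →
    (γ ≡ α ++ (β ++ δ)) × (0 < length G β) × (0 < length G δ)

  unique⊎loop : ∀ {i j} (γ : Walk G i j) → Unique (vertices G γ) ⊎ ProperLoop γ
  unique⊎loop [] = inj₁ []
  unique⊎loop (_∷_ {i} A γ) with _∈?_ _≟_ i (vertices G γ)
  ... | yes i∈ with split-at γ i∈
  ...   | β , δ , ≡.refl , 0<δ = inj₂ (i , [] , A ∷ β , δ , ≡.refl , s≤s z≤n , 0<δ)
  unique⊎loop (_∷_ {i} A γ) | no i∉ with unique⊎loop γ
  ... | inj₁ u = inj₁ (¬Any⇒All¬ (vertices G γ) i∉ ∷ u)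
  ... | inj₂ (k , α , β , δ , ≡.refl , 0<β , 0<δ) = inj₂ (k , A ∷ α , β , δ , ≡.refl , 0<β , 0<δ)

  -- Cutting a closed walk at repeated vertices reduces it to cycles and back-and-forth steps.
  closed-walk-induction : (P : ∀ {i} → Walk G i i → Set) →
    (∀ {i} → P ([] {i = i})) →
    (∀ {i j} (A : Adjacent G i j) (B : Adjacent G j i) → P (A ∷ B ∷ [])) →
    (∀ {i} (γ : Walk G i i) → IsCycle G γ → P γ) →
    (∀ {i k} (α : Walk G i k) (β : Walk G k k) (δ : Walk G k i) → P (α ++ δ) → P β → P (α ++ (β ++ δ))) →
    ∀ {i} (γ : Walk G i i) → P γ
  closed-walk-induction P p[] p₂ pC p++ γ = go (suc (length G γ)) γ ℕₚ.≤-refl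
    where
    base : ∀ {i} (γ : Walk G i i) → Unique (vertices G γ) → P γ
    base [] _ = p[]
    -- A closed walk of length one would be a loop. Length two with distinct vertices goes along an
    -- adjacency and back, and from length three on it is a cycle.
    base ((e , inj₁ (p , q)) ∷ []) _ with () ← OrientedGraph.loopless G e (≡.trans p (≡.sym q))
    base ((e , inj₂ (p , q)) ∷ []) _ with () ← OrientedGraph.loopless G e (≡.trans p (≡.sym q))
    base (A ∷ B ∷ []) _ = p₂ A B
    base γ@(_ ∷ _ ∷ _ ∷ _) u = pC γ (s≤s (s≤s (s≤s z≤n)) , u)

    -- Recursion on a strict bound for the length. Removing `β` shortens the walk because `β` is
    -- nonempty, and `β` itself is shorter because `δ` is nonempty.
    go : ∀ b {i} (γ : Walk G i i) → length G γ < b → P γ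
    go (suc b) γ (s≤s ≤b) with unique⊎loop γ
    ... | inj₁ u = base γ u
    ... | inj₂ (_ , α , β , δ , ≡.refl , 0<β , 0<δ) =
      p++ α β δ (go b (α ++ δ) (ℕₚ.<-≤-trans shorter₁ ≤b)) (go b β (ℕₚ.<-≤-trans shorter₂ ≤b))
      where
      total : length G (α ++ (β ++ δ)) ≡ length G α ℕ.+ (length G β ℕ.+ length G δ)
      total = ≡.trans (length-++ α (β ++ δ)) (≡.cong (length G α ℕ.+_) (length-++ β δ))
      shorter₁ : length G (α ++ δ) < length G (α ++ (β ++ δ))
      shorter₁ rewrite total | length-++ α δ =
        ℕₚ.+-monoʳ-< (length G α) (ℕₚ.m<n+m (length G δ) 0<β)
      shorter₂ : length G β < length G (α ++ (β ++ δ))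
      shorter₂ rewrite total =
        ℕₚ.<-≤-trans (ℕₚ.m<m+n (length G β) 0<δ) (ℕₚ.m≤n+m _ (length G α))

-- Gains of walks in an integral domain with an involution

record IsConjugationDomain (R : CommutativeRing 0ℓ 0ℓ)
  (conj : CommutativeRing.Carrier R → CommutativeRing.Carrier R) : Set where
  open CommutativeRing R
  field
    1≉0             : ¬ (1# ≈ 0#)
    xy≈0⇒x≈0        : ∀ x y → x * y ≈ 0# → ¬ (y ≈ 0#) → x ≈ 0#
    conj-cong       : ∀ {x y} → x ≈ y → conj x ≈ conj y
    conj-+          : ∀ x y → conj (x + y) ≈ conj x + conj y
    conj-*          : ∀ x y → conj (x * y) ≈ conj x * conj y
    conj-neg        : ∀ x → conj (- x) ≈ - conj x
    conj-0          : conj 0# ≈ 0#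
    conj-1          : conj 1# ≈ 1#
    conj-involutive : ∀ x → conj (conj x) ≈ x

module Domain (R : CommutativeRing 0ℓ 0ℓ)
  (conj : CommutativeRing.Carrier R → CommutativeRing.Carrier R)
  (isConjugationDomain : IsConjugationDomain R conj) where

  open CommutativeRing R
  open IsConjugationDomain isConjugationDomain
  open RingProperties ring using (x∙y⁻¹≈ε⇒x≈y; x≈y⇒x∙y⁻¹≈ε; [y-z]x≈yx-zx; -‿distribʳ-*; -‿distribˡ-*;
    +-cancelʳ; -‿involutive; -1*x≈-x; +-inverseˡ-unique; //-rightDividesʳ)
  open MonoidSum +-commutativeMonoid using (sum; sum-remove; ∑-distrib-+; ∑-comm; sum-cong-≋; sum-replicate; sum-replicate-zero)
  open SemiringSum semiring using (*-distribˡ-sum; *-distribʳ-sum)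
  open SemiringMult semiring using (×-assoc-*; ×-comm-*) renaming (_×_ to _×ᴿ_)
  open SemiringSolver commutativeSemiring using (solve; _:*_; _:+_; _:=_; con)
  open SetoidReasoning setoid

  -- Cancellation, signs and square roots in the domain

  x*z≈y*z⇒x≈y : ∀ {x y z} → ¬ (z ≈ 0#) → x * z ≈ y * z → x ≈ y
  x*z≈y*z⇒x≈y {x} {y} {z} z≉0 eq = x∙y⁻¹≈ε⇒x≈y x y
    (xy≈0⇒x≈0 (x - y) z (trans ([y-z]x≈yx-zx z x y) (x≈y⇒x∙y⁻¹≈ε eq)) z≉0)

  *-≉0 : ∀ {x y} → ¬ (x ≈ 0#) → ¬ (y ≈ 0#) → ¬ (x * y ≈ 0#)
  *-≉0 x≉0 y≉0 xy≈0 = x≉0 (xy≈0⇒x≈0 _ _ xy≈0 y≉0)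

  -x*-y : ∀ x y → - x * - y ≈ x * y
  -x*-y x y = trans (sym (-‿distribˡ-* x (- y)))
    (trans (-‿cong (sym (-‿distribʳ-* x y))) (-‿involutive (x * y)))

  -1*-1*x : ∀ x → - 1# * (- 1# * x) ≈ x
  -1*-1*x x = trans (sym (*-assoc _ _ _))
    (trans (*-congʳ (trans (-x*-y 1# 1#) (*-identityˡ 1#))) (*-identityˡ x))

  -- The induction step for `κ≈±wt`: `x` is the entry of the first edge, `p` the sign and `y` the
  -- weight of the remaining walk, whose gain is `k`.
  signed-step : ∀ x {y p k} → k ≈ p * y → - x * k ≈ (- 1# * p) * (x * y)
  signed-step x {y} {p} {k} eq = begin
    - x * k                 ≈⟨ *-cong (sym (-1*x≈-x x)) eq ⟩
    (- 1# * x) * (p * y)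
      ≈⟨ solve 4 (λ t x p y → (t :* x) :* (p :* y) := (t :* p) :* (x :* y)) refl (- 1#) x p y ⟩
    (- 1# * p) * (x * y)    ∎

  unscale : ∀ {k p y} → k ≈ p * y → p ≈ 1# → k ≈ y
  unscale k≈py p≈1 = trans k≈py (trans (*-congʳ p≈1) (*-identityˡ _))

  unscale-neg : ∀ {k p y} → k ≈ p * y → p ≈ - 1# → k ≈ - y
  unscale-neg k≈py p≈-1 = trans k≈py (trans (*-congʳ p≈-1) (-1*x≈-x _))

  -- Since x(x + y) = y(x + y), the sum can be cancelled. This identifies principal square roots and
  -- moduli: signs of real parts show that the two candidates cannot add up to zero.
  square-injective : ∀ {x y} → x * x ≈ y * y → ¬ (x + y ≈ 0#) → x ≈ y
  square-injective {x} {y} eq x+y≉0 = x*z≈y*z⇒x≈y x+y≉0 (begin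
    x * (x + y)    ≈⟨ distribˡ x x y ⟩
    x * x + x * y  ≈⟨ +-congʳ eq ⟩
    y * y + x * y  ≈⟨ solve 2 (λ a b → b :* b :+ a :* b := b :* (a :+ b)) refl x y ⟩
    y * (x + y)    ∎)

  conj-≉0 : ∀ {x} → ¬ (x ≈ 0#) → ¬ (conj x ≈ 0#)
  conj-≉0 {x} x≉0 eq = x≉0 (trans (sym (conj-involutive x)) (trans (conj-cong eq) conj-0))

  -- Sums with few non-zero terms, and matrix products

  sum-zero : ∀ {n} {f : Fin n → Carrier} → (∀ k → f k ≈ 0#) → sum f ≈ 0#
  sum-zero {n} f≈0 = trans (sum-cong-≋ f≈0) (sum-replicate-zero n)

  sum-support₁ : ∀ {n} (f : Fin n → Carrier) j → (∀ k → k ≢ j → f k ≈ 0#) → sum f ≈ f j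
  sum-support₁ {suc n} f j off = begin
    sum f                             ≈⟨ sum-remove {i = j} f ⟩
    f j + sum (Vector.removeAt f j)   ≈⟨ +-congˡ (sum-zero λ k → off (punchIn j k) (punchInᵢ≢i j k)) ⟩
    f j + 0#                          ≈⟨ +-identityʳ (f j) ⟩
    f j                               ∎

  -- Removing index `i` leaves a family supported at the single position `punchOut i≢j`. It serves
  -- for the columns of the incidence matrix, which are non-zero only at the two ends of an edge.
  sum-support₂ : ∀ {n} (f : Fin n → Carrier) i j → i ≢ j →
    (∀ k → k ≢ i → k ≢ j → f k ≈ 0#) → sum f ≈ f i + f j
  sum-support₂ {suc n} f i j i≢j off = trans (sum-remove {i = i} f) (+-congˡ (trans
    (sum-support₁ (Vector.removeAt f i) (punchOut i≢j) λ k k≢ →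
      off (punchIn i k) (punchInᵢ≢i i k)
        λ eq → k≢ (punchIn-injective i k (punchOut i≢j) (≡.trans eq (≡.sym (punchIn-punchOut i≢j)))))
    (reflexive (≡.cong f (punchIn-punchOut i≢j)))))

  infixl 7 _⊗_

  _⊗_ : ∀ {m n p} → (Fin m → Fin n → Carrier) → (Fin n → Fin p → Carrier) → Fin m → Fin p → Carrier
  (A ⊗ B) i k = sum (λ j → A i j * B j k)

  module _ {n} (δ : Fin n → Fin n → Carrier)
    (δ-diagonal : ∀ i → δ i i ≈ 1#) (δ-off : ∀ {i j} → i ≢ j → δ i j ≈ 0#) where

    sum-δˡ : ∀ (f : Fin n → Carrier) i → sum (λ k → δ i k * f k) ≈ f i
    sum-δˡ f i = trans
      (sum-support₁ _ i λ k k≢i → trans (*-congʳ (δ-off (k≢i ∘ ≡.sym))) (zeroˡ (f k)))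
      (trans (*-congʳ (δ-diagonal i)) (*-identityˡ (f i)))

    sum-δʳ : ∀ (f : Fin n → Carrier) j → sum (λ k → f k * δ k j) ≈ f j
    sum-δʳ f j = trans
      (sum-support₁ _ j λ k k≢j → trans (*-congˡ (δ-off k≢j)) (zeroʳ (f k)))
      (trans (*-congˡ (δ-diagonal j)) (*-identityʳ (f j)))

  -- In the application σ e is the principal square root of the weight of e
  -- and b i j = - a_{ij}, so that κ γ = (-1)^{length γ} wt γ and ρ γ = ∣ wt γ ∣.
  module Gains {n} (G : OrientedGraph n)
    (σ : Fin (OrientedGraph.m G) → Carrier) (σ≉0 : ∀ e → ¬ (σ e ≈ 0#))
    (b : Fin n → Fin n → Carrier)
    (b-src-tgt : ∀ e → b (OrientedGraph.src G e) (OrientedGraph.tgt G e) ≈ - (σ e * σ e))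
    (b-tgt-src : ∀ e → b (OrientedGraph.tgt G e) (OrientedGraph.src G e) ≈ - (conj (σ e) * conj (σ e)))
    where

    open OrientedGraph G
    open Walks G

    -- The modulus of the weight σ² of the edge, expressed without a further square root.
    ∥_∥ : Fin m → Carrier
    ∥ e ∥ = σ e * conj (σ e)

    ρ κ : ∀ {i j} → Walk G i j → Carrier
    ρ []      = 1#
    ρ (A ∷ γ) = ∥ proj₁ A ∥ * ρ γ
    κ []                  = 1#
    κ (_∷_ {i} {j} A γ) = b i j * κ γ

    ρ-++ : ∀ {i j k} (γ : Walk G i j) (δ : Walk G j k) → ρ (γ ++ δ) ≈ ρ γ * ρ δ
    ρ-++ []      δ = sym (*-identityˡ _)
    ρ-++ (A ∷ γ) δ = trans (*-congˡ (ρ-++ γ δ)) (sym (*-assoc _ _ _))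

    κ-++ : ∀ {i j k} (γ : Walk G i j) (δ : Walk G j k) → κ (γ ++ δ) ≈ κ γ * κ δ
    κ-++ []      δ = sym (*-identityˡ _)
    κ-++ (A ∷ γ) δ = trans (*-congˡ (κ-++ γ δ)) (sym (*-assoc _ _ _))

    ρ≉0 : ∀ {i j} (γ : Walk G i j) → ¬ (ρ γ ≈ 0#)
    ρ≉0 []      = 1≉0
    ρ≉0 (A ∷ γ) = *-≉0 (*-≉0 (σ≉0 _) (conj-≉0 (σ≉0 _))) (ρ≉0 γ)

    conj-ρ : ∀ {i j} (γ : Walk G i j) → conj (ρ γ) ≈ ρ γ
    conj-ρ []      = conj-1
    conj-ρ (A ∷ γ) = trans (conj-* _ _) (*-cong
      (trans (conj-* _ _) (trans (*-congˡ (conj-involutive _)) (*-comm _ _)))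
      (conj-ρ γ))

    conj-b : ∀ {i j} → Adjacent G i j → conj (b i j) ≈ b j i
    conj-b (e , inj₁ (≡.refl , ≡.refl)) = trans (conj-cong (b-src-tgt e))
      (trans (conj-neg _) (trans (-‿cong (conj-* _ _)) (sym (b-tgt-src e))))
    conj-b (e , inj₂ (≡.refl , ≡.refl)) = trans (conj-cong (b-tgt-src e))
      (trans (conj-neg _) (trans (-‿cong (trans (conj-* _ _)
        (*-cong (conj-involutive _) (conj-involutive _)))) (sym (b-src-tgt e))))

    b*b : ∀ {i j} (A : Adjacent G i j) → b i j * b j i ≈ ∥ proj₁ A ∥ * ∥ proj₁ A ∥
    b*b (e , inj₁ (≡.refl , ≡.refl)) = trans (*-cong (b-src-tgt e) (b-tgt-src e)) (trans (-x*-y _ _)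
      (solve 2 (λ x y → (x :* x) :* (y :* y) := (x :* y) :* (x :* y)) refl (σ e) (conj (σ e))))
    b*b (e , inj₂ (≡.refl , ≡.refl)) = trans (*-cong (b-tgt-src e) (b-src-tgt e)) (trans (-x*-y _ _)
      (solve 2 (λ x y → (y :* y) :* (x :* x) := (x :* y) :* (x :* y)) refl (σ e) (conj (σ e))))

    -- Conjugating `b i j` gives `b j i`, so every edge contributes `b i j * b j i`, the square of
    -- its modulus. This is ∣κ γ∣ = ρ γ in squared form.
    κ*conj : ∀ {i j} (γ : Walk G i j) → κ γ * conj (κ γ) ≈ ρ γ * ρ γ
    κ*conj [] = *-congˡ conj-1
    κ*conj (_∷_ {i} {j} A γ) = begin
      (b i j * κ γ) * conj (b i j * κ γ)           ≈⟨ *-congˡ (trans (conj-* _ _) (*-congʳ (conj-b A))) ⟩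
      (b i j * κ γ) * (b j i * conj (κ γ))         ≈⟨ shuffle _ _ _ _ ⟩
      (b i j * b j i) * (κ γ * conj (κ γ))         ≈⟨ *-cong (b*b A) (κ*conj γ) ⟩
      (∥ e ∥ * ∥ e ∥) * (ρ γ * ρ γ)                ≈⟨ shuffle _ _ _ _ ⟩
      (∥ e ∥ * ρ γ) * (∥ e ∥ * ρ γ)                ∎
      where
      e = proj₁ A
      shuffle : ∀ w x y z → (w * x) * (y * z) ≈ (w * y) * (x * z)
      shuffle = solve 4 (λ w x y z → (w :* x) :* (y :* z) := (w :* y) :* (x :* z)) refl

    κ≉0 : ∀ {i j} (γ : Walk G i j) → ¬ (κ γ ≈ 0#)
    κ≉0 γ κ≈0 = *-≉0 (ρ≉0 γ) (ρ≉0 γ)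
      (trans (sym (κ*conj γ)) (trans (*-congʳ κ≈0) (zeroˡ _)))

    -- `ρ` reads the edge index stored in a step while `κ` sees only its endpoints, so comparing
    -- them on a back-and-forth walk requires equal indices. If `e` and `f` run in opposite
    -- directions they are antiparallel, which is excluded; otherwise they are parallel, hence
    -- equal.
    same-edge : ∀ {i j} (A : Adjacent G i j) (B : Adjacent G j i) → proj₁ A ≡ proj₁ B
    same-edge (e , inj₁ (≡.refl , ≡.refl)) (f , inj₁ (p , q)) = ⊥-elim (no-antiparallel e f (≡.sym q) (≡.sym p))
    same-edge (e , inj₁ (≡.refl , ≡.refl)) (f , inj₂ (p , q)) = no-parallel e f (≡.sym p) (≡.sym q)
    same-edge (e , inj₂ (≡.refl , ≡.refl)) (f , inj₁ (p , q)) = no-parallel e f (≡.sym p) (≡.sym q)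
    same-edge (e , inj₂ (≡.refl , ≡.refl)) (f , inj₂ (p , q)) = ⊥-elim (no-antiparallel e f (≡.sym q) (≡.sym p))

    -- Balance in the sense of gain graphs, for the unit gain κ γ / ρ γ.
    Balanced : Set
    Balanced = ∀ {i} (γ : Walk G i i) → κ γ ≈ ρ γ

    -- Both `κ` and `ρ` are multiplicative with commuting values, so a loop can be pulled out of the
    -- middle of a walk. A back-and-forth step has equal `κ` and `ρ` by `b*b`.
    cycles⇒balanced : (∀ {i} (C : Walk G i i) → IsCycle G C → κ C ≈ ρ C) → Balanced
    cycles⇒balanced cycles = closed-walk-induction (λ γ → κ γ ≈ ρ γ) refl
      (λ {i} {j} A B → begin
        b i j * (b j i * 1#)                          ≈⟨ sym (*-assoc _ _ _) ⟩
        (b i j * b j i) * 1#                          ≈⟨ *-congʳ (b*b A) ⟩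
        (∥ proj₁ A ∥ * ∥ proj₁ A ∥) * 1#              ≈⟨ *-assoc _ _ _ ⟩
        ∥ proj₁ A ∥ * (∥ proj₁ A ∥ * 1#)              ≈⟨ *-congˡ (*-congʳ (reflexive (≡.cong ∥_∥ (same-edge A B)))) ⟩
        ∥ proj₁ A ∥ * (∥ proj₁ B ∥ * 1#)              ∎)
      cycles
      (λ α β δ αδ β′ → begin
        κ (α ++ (β ++ δ))        ≈⟨ trans (κ-++ α (β ++ δ)) (*-congˡ (κ-++ β δ)) ⟩
        κ α * (κ β * κ δ)        ≈⟨ shuffle _ _ _ ⟩
        (κ α * κ δ) * κ β        ≈⟨ *-cong (trans (sym (κ-++ α δ)) (trans αδ (ρ-++ α δ))) β′ ⟩
        (ρ α * ρ δ) * ρ β        ≈⟨ shuffle _ _ _ ⟨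
        ρ α * (ρ β * ρ δ)        ≈⟨ trans (ρ-++ α (β ++ δ)) (*-congˡ (ρ-++ β δ)) ⟨
        ρ (α ++ (β ++ δ))        ∎)
      where
      shuffle : ∀ x y z → x * (y * z) ≈ (x * z) * y
      shuffle = solve 3 (λ x y z → x :* (y :* z) := (x :* z) :* y) refl

    -- The equation q N = 0 read column by column; `sum-qN` makes the link with the matrix.
    IsLeftNull : (Fin n → Carrier) → Set
    IsLeftNull q = ∀ e → q (src e) * σ e + q (tgt e) * conj (σ e) ≈ 0#

    module _ {q : Fin n → Carrier} (null : IsLeftNull q) where

      -- The null equation of the edge is multiplied by `σ e` if the edge is followed forwards, and
      -- by `conj (σ e)` if backwards. One term then carries the modulus and the other the squared
      -- root, which is `- b i j`.
      transport-step : ∀ {i j} (A : Adjacent G i j) → q j * ∥ proj₁ A ∥ ≈ q i * b i j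
      transport-step (e , inj₁ (≡.refl , ≡.refl)) = trans
        (+-inverseˡ-unique _ (q (src e) * (σ e * σ e)) (begin
          q (tgt e) * (σ e * conj (σ e)) + q (src e) * (σ e * σ e)
            ≈⟨ solve 4 (λ u v x y → v :* (x :* y) :+ u :* (x :* x) := x :* (u :* x :+ v :* y)) refl
                 (q (src e)) (q (tgt e)) (σ e) (conj (σ e)) ⟩
          σ e * (q (src e) * σ e + q (tgt e) * conj (σ e)) ≈⟨ *-congˡ (null e) ⟩
          σ e * 0# ≈⟨ zeroʳ (σ e) ⟩
          0# ∎))
        (trans (-‿distribʳ-* _ _) (*-congˡ (sym (b-src-tgt e))))
      transport-step (e , inj₂ (≡.refl , ≡.refl)) = trans
        (+-inverseˡ-unique _ (q (tgt e) * (conj (σ e) * conj (σ e))) (begin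
          q (src e) * (σ e * conj (σ e)) + q (tgt e) * (conj (σ e) * conj (σ e))
            ≈⟨ solve 4 (λ u v x y → u :* (x :* y) :+ v :* (y :* y) := y :* (u :* x :+ v :* y)) refl
                 (q (src e)) (q (tgt e)) (σ e) (conj (σ e)) ⟩
          conj (σ e) * (q (src e) * σ e + q (tgt e) * conj (σ e)) ≈⟨ *-congˡ (null e) ⟩
          conj (σ e) * 0# ≈⟨ zeroʳ _ ⟩
          0# ∎))
        (trans (-‿distribʳ-* _ _) (*-congˡ (sym (b-tgt-src e))))

      transport : ∀ {i j} (γ : Walk G i j) → q j * ρ γ ≈ q i * κ γ
      transport [] = refl
      transport {i} {j} (_∷_ {j = k} A γ) = begin
        q j * (∥ proj₁ A ∥ * ρ γ)   ≈⟨ shuffle _ _ _ ⟩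
        (q j * ρ γ) * ∥ proj₁ A ∥   ≈⟨ *-congʳ (transport γ) ⟩
        (q k * κ γ) * ∥ proj₁ A ∥   ≈⟨ trans (sym (shuffle _ _ _)) (sym (*-assoc _ _ _)) ⟩
        (q k * ∥ proj₁ A ∥) * κ γ   ≈⟨ *-congʳ (transport-step A) ⟩
        (q i * b i k) * κ γ         ≈⟨ *-assoc _ _ _ ⟩
        q i * (b i k * κ γ)         ∎
        where
        shuffle : ∀ x y z → x * (y * z) ≈ (x * z) * y
        shuffle = solve 3 (λ x y z → x :* (y :* z) := (x :* z) :* y) refl

      unbalanced⇒0 : WeaklyConnected G → ∀ {i} (C : Walk G i i) → ¬ (κ C ≈ ρ C) → ∀ j → q j ≈ 0#
      unbalanced⇒0 connected {i} C unbalanced j = xy≈0⇒x≈0 (q j) (ρ γ)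
        (trans (transport γ) (trans (*-congʳ qi≈0) (zeroˡ _))) (ρ≉0 γ)
        where
        γ = connected i j
        qi≈0 : q i ≈ 0#
        qi≈0 = xy≈0⇒x≈0 (q i) (ρ C - κ C)
          (trans (distribˡ _ _ _) (trans (+-congˡ (sym (-‿distribʳ-* _ _))) (x≈y⇒x∙y⁻¹≈ε (transport C))))
          (λ eq → unbalanced (sym (x∙y⁻¹≈ε⇒x≈y _ _ eq)))

    -- The projection N N⁺ and its complement

    module Projection
      (connected : WeaklyConnected G)
      (N : Fin n → Fin m → Carrier)
      (N-src : ∀ e → N (src e) e ≈ σ e) (N-tgt : ∀ e → N (tgt e) e ≈ conj (σ e))
      (N-off : ∀ i e → i ≢ src e → i ≢ tgt e → N i e ≈ 0#)
      (X : Fin m → Fin n → Carrier)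
      (PN≈N : ∀ i e → ((N ⊗ X) ⊗ N) i e ≈ N i e)
      (P-hermitian : ∀ i j → conj ((N ⊗ X) j i) ≈ (N ⊗ X) i j)
      (δ : Fin n → Fin n → Carrier)
      (δ-diagonal : ∀ i → δ i i ≈ 1#) (δ-off : ∀ {i j} → i ≢ j → δ i j ≈ 0#)
      where

      P : Fin n → Fin n → Carrier
      P = N ⊗ X

      sum-qN : ∀ (q : Fin n → Carrier) e →
        sum (λ k → q k * N k e) ≈ q (src e) * σ e + q (tgt e) * conj (σ e)
      sum-qN q e = trans
        (sum-support₂ _ (src e) (tgt e) (loopless e)
          λ k ≢s ≢t → trans (*-congˡ (N-off k e ≢s ≢t)) (zeroʳ (q k)))
        (+-cong (*-congˡ (N-src e)) (*-congˡ (N-tgt e)))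

      -- As P = N X is Hermitian with P N = N, it is the orthogonal projection onto the column space
      -- of N, and `Q` projects onto the orthogonal complement.
      Q : Fin n → Fin n → Carrier
      Q i j = δ i j - P i j

      Q+P : ∀ i j → Q i j + P i j ≈ δ i j
      Q+P i j = trans (+-assoc _ _ _) (trans (+-congˡ (-‿inverseˡ _)) (+-identityʳ _))

      Q-null : ∀ i → IsLeftNull (Q i)
      -- P N = N is added on both sides: (Q + P) N = N = 0 + N, and N is cancelled.
      Q-null i e = trans (sym (sum-qN (Q i) e)) (+-cancelʳ (N i e) _ _ (begin
        sum (λ k → Q i k * N k e) + N i e                          ≈⟨ +-congˡ (PN≈N i e) ⟨
        sum (λ k → Q i k * N k e) + sum (λ k → P i k * N k e)
          ≈⟨ ∑-distrib-+ (λ k → Q i k * N k e) (λ k → P i k * N k e) ⟨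
        sum (λ k → Q i k * N k e + P i k * N k e)
          ≈⟨ sum-cong-≋ (λ k → trans (sym (distribʳ _ _ _)) (*-congʳ (Q+P i k))) ⟩
        sum (λ k → δ i k * N k e)                                  ≈⟨ sum-δˡ δ δ-diagonal δ-off (λ k → N k e) i ⟩
        N i e                                                      ≈⟨ +-identityˡ _ ⟨
        0# + N i e                                                 ∎))

      unbalanced⇒P≈δ : ∀ {i} (C : Walk G i i) → ¬ (κ C ≈ ρ C) → ∀ j k → P j k ≈ δ j k
      unbalanced⇒P≈δ C unbalanced j k =
        sym (x∙y⁻¹≈ε⇒x≈y _ _ (unbalanced⇒0 (Q-null j) connected C unbalanced k))

      conj-δ : ∀ i j → conj (δ j i) ≈ δ i j
      conj-δ i j with i ≟ j
      ... | yes ≡.refl = trans (conj-cong (δ-diagonal i)) (trans conj-1 (sym (δ-diagonal i)))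
      ... | no i≢j = trans (conj-cong (δ-off (i≢j ∘ ≡.sym))) (trans conj-0 (sym (δ-off i≢j)))

      Q-hermitian : ∀ i j → conj (Q j i) ≈ Q i j
      Q-hermitian i j = trans (conj-+ _ _)
        (+-cong (conj-δ i j) (trans (conj-neg _) (-‿cong (P-hermitian i j))))

      -- From q N = 0 follows q P = (q N) X = 0 after exchanging the two sums, so q = q (Q + P) = q
      -- Q.
      leftNull⇒fixed : ∀ {q} → IsLeftNull q → ∀ j → sum (λ k → q k * Q k j) ≈ q j
      leftNull⇒fixed {q} null j = begin
        sum (λ k → q k * Q k j)                                 ≈⟨ +-identityʳ _ ⟨
        sum (λ k → q k * Q k j) + 0#                            ≈⟨ +-congˡ qP≈0 ⟨
        sum (λ k → q k * Q k j) + sum (λ k → q k * P k j)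
          ≈⟨ ∑-distrib-+ (λ k → q k * Q k j) (λ k → q k * P k j) ⟨
        sum (λ k → q k * Q k j + q k * P k j)
          ≈⟨ sum-cong-≋ (λ k → trans (sym (distribˡ _ _ _)) (*-congˡ (Q+P k j))) ⟩
        sum (λ k → q k * δ k j)                                 ≈⟨ sum-δʳ δ δ-diagonal δ-off q j ⟩
        q j                                                     ∎
        where
        qP≈0 : sum (λ k → q k * P k j) ≈ 0#
        qP≈0 = begin
          sum (λ k → q k * sum (λ e → N k e * X e j))
            ≈⟨ sum-cong-≋ (λ k → trans (*-distribˡ-sum (q k) (λ e → N k e * X e j)) 
                 (sum-cong-≋ {m} (λ e → sym (*-assoc (q k) (N k e) (X e j))))) ⟩
          sum (λ k → sum (λ e → (q k * N k e) * X e j))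
            ≈⟨ ∑-comm (λ k e → (q k * N k e) * X e j) ⟩
          sum (λ e → sum (λ k → (q k * N k e) * X e j))
            ≈⟨ sum-zero (λ e → trans (sym (*-distribʳ-sum (X e j) (λ k → q k * N k e)))
                 (trans (*-congʳ (trans (sum-qN q e) (null e))) (zeroˡ _))) ⟩
          0# ∎

      -- Balanced graphs: the entries of Q in terms of S

      module _ (balanced : Balanced)
        (S : Fin n → Fin n → Carrier) (walk : ∀ i j → Walk G i j)
        (S-def : ∀ i j → S i j * ρ (walk i j) ≈ κ (walk i j))
        (1/n : Carrier) (n×1/n≈1 : n ×ᴿ 1/n ≈ 1#)
        where

        -- The walks `γ₁` to `u` and `γ₂` to `v` may be unrelated, so both are closed up by one
        -- return walk `δ′` from `v` to `i`, the first after crossing `e`. Balance of these two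
        -- closed walks relates `S i u` to `S i v`.
        S-null : ∀ i → IsLeftNull (S i)
        -- In the auxiliary factor, `ρ γ₁` and `ρ γ₂` clear the denominators of the two entries of
        -- `S`, `κ δ′` completes the closed walks, and `σ e` turns the coefficients into σ² and the
        -- modulus of the edge.
        S-null i e = xy≈0⇒x≈0 _ (((ρ γ₁ * ρ γ₂) * κ δ′) * σ e) (begin
          (S i u * s + S i v * s̄) * (((ρ γ₁ * ρ γ₂) * κ δ′) * s)
            ≈⟨ solve 7 (λ S₁ S₂ x y r₁ r₂ k →
                 (S₁ :* x :+ S₂ :* y) :* (((r₁ :* r₂) :* k) :* x)
                 := ((S₁ :* r₁) :* k) :* ((x :* x) :* r₂) :+ ((S₂ :* r₂) :* k) :* ((x :* y) :* r₁)) refl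
                 (S i u) (S i v) s s̄ (ρ γ₁) (ρ γ₂) (κ δ′) ⟩
          ((S i u * ρ γ₁) * κ δ′) * ((s * s) * ρ γ₂) + ((S i v * ρ γ₂) * κ δ′) * (∥ e ∥ * ρ γ₁)
            ≈⟨ +-cong (*-congʳ (*-congʳ (S-def i u))) (*-congʳ (trans (*-congʳ (S-def i v)) closed₂)) ⟩
          (κ γ₁ * κ δ′) * ((s * s) * ρ γ₂) + (ρ γ₂ * ρ δ′) * (∥ e ∥ * ρ γ₁)
            ≈⟨ +-congˡ (solve 4 (λ r₂ r x r₁ → (r₂ :* r) :* (x :* r₁) := (r₁ :* (x :* r)) :* r₂) refl
                 (ρ γ₂) (ρ δ′) ∥ e ∥ (ρ γ₁)) ⟩
          (κ γ₁ * κ δ′) * ((s * s) * ρ γ₂) + (ρ γ₁ * (∥ e ∥ * ρ δ′)) * ρ γ₂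
            -- Balance is read backwards here, so that the edge reappears as `b u v`, which is minus
            -- σ² and cancels the first summand.
            ≈⟨ +-congˡ (*-congʳ (trans (sym closed₁) (*-congˡ (*-congʳ (b-src-tgt e))))) ⟩
          (κ γ₁ * κ δ′) * ((s * s) * ρ γ₂) + (κ γ₁ * (- (s * s) * κ δ′)) * ρ γ₂
            ≈⟨ solve 5 (λ k₁ k t t′ r → (k₁ :* k) :* (t :* r) :+ (k₁ :* (t′ :* k)) :* r
                 := (t :+ t′) :* ((k₁ :* k) :* r)) refl (κ γ₁) (κ δ′) (s * s) (- (s * s)) (ρ γ₂) ⟩
          (s * s - s * s) * ((κ γ₁ * κ δ′) * ρ γ₂)   ≈⟨ *-congʳ (-‿inverseʳ (s * s)) ⟩
          0# * ((κ γ₁ * κ δ′) * ρ γ₂)                ≈⟨ zeroˡ _ ⟩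
          0#                                         ∎)
          (*-≉0 (*-≉0 (*-≉0 (ρ≉0 γ₁) (ρ≉0 γ₂)) (κ≉0 δ′)) (σ≉0 e))
          where
          u = src e
          v = tgt e
          s = σ e
          s̄ = conj (σ e)
          γ₁ = walk i u
          γ₂ = walk i v
          δ′ = connected v i
          A : Adjacent G u v
          A = e , inj₁ (≡.refl , ≡.refl)
          closed₁ : κ γ₁ * (b u v * κ δ′) ≈ ρ γ₁ * (∥ e ∥ * ρ δ′)
          closed₁ = trans (sym (κ-++ γ₁ (A ∷ δ′))) (trans (balanced (γ₁ ++ (A ∷ δ′))) (ρ-++ γ₁ (A ∷ δ′)))
          closed₂ : κ γ₂ * κ δ′ ≈ ρ γ₂ * ρ δ′
          closed₂ = trans (sym (κ-++ γ₂ δ′)) (trans (balanced (γ₂ ++ δ′)) (ρ-++ γ₂ δ′))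

        S-diagonal : ∀ i → S i i ≈ 1#
        S-diagonal i = x*z≈y*z⇒x≈y (ρ≉0 (walk i i))
          (trans (S-def i i) (trans (balanced (walk i i)) (sym (*-identityˡ _))))

        S-unit : ∀ i j → S i j * conj (S i j) ≈ 1#
        S-unit i j = x*z≈y*z⇒x≈y (*-≉0 (ρ≉0 γ) (ρ≉0 γ)) (begin
          (S i j * conj (S i j)) * (ρ γ * ρ γ)
            ≈⟨ solve 3 (λ x y r → (x :* y) :* (r :* r) := (x :* r) :* (y :* r)) refl _ _ _ ⟩
          (S i j * ρ γ) * (conj (S i j) * ρ γ)
            ≈⟨ *-cong (S-def i j) (trans (*-congˡ (sym (conj-ρ γ))) (trans (sym (conj-* _ _)) (conj-cong (S-def i j)))) ⟩
          κ γ * conj (κ γ)        ≈⟨ κ*conj γ ⟩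
          ρ γ * ρ γ               ≈⟨ *-identityˡ _ ⟨
          1# * (ρ γ * ρ γ)        ∎)
          where γ = walk i j

        -- Transporting row i of `Q` from `i` along `walk i j` multiplies its entry by κ / ρ of that
        -- walk, and this ratio is `S i j`.
        Q≈Qᵢᵢ*S : ∀ i j → Q i j ≈ Q i i * S i j
        Q≈Qᵢᵢ*S i j = x*z≈y*z⇒x≈y (ρ≉0 (walk i j)) (trans (transport (Q-null i) (walk i j))
          (trans (*-congˡ (sym (S-def i j))) (sym (*-assoc _ _ _))))

        n×Qᵢᵢ≈1 : ∀ i → n ×ᴿ Q i i ≈ 1#
        n×Qᵢᵢ≈1 i = begin
          n ×ᴿ Q i i                     ≈⟨ sum-replicate n ⟨
          -- Each summand `S i k * Q k i` equals `Q i i`: by hermiticity `Q k i` is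
          -- `Q i i * conj (S i k)`, and `S i k` has modulus one.
          sum (Vector.replicate n (Q i i)) ≈⟨ sum-cong-≋ (λ k → begin
            Q i i                                ≈⟨ *-identityʳ _ ⟨
            Q i i * 1#                           ≈⟨ *-congˡ (S-unit i k) ⟨
            Q i i * (S i k * conj (S i k))       ≈⟨ solve 3 (λ x y z → x :* (y :* z) := y :* (x :* z)) refl _ _ _ ⟩
            S i k * (Q i i * conj (S i k))       ≈⟨ *-congˡ (*-congʳ (Q-hermitian i i)) ⟨
            S i k * (conj (Q i i) * conj (S i k)) ≈⟨ *-congˡ (trans (conj-cong (Q≈Qᵢᵢ*S i k)) (conj-* _ _)) ⟨
            S i k * conj (Q i k)                 ≈⟨ *-congˡ (Q-hermitian k i) ⟩
            S i k * Q k i                        ∎) ⟩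
          sum (λ k → S i k * Q k i)      ≈⟨ leftNull⇒fixed (S-null i) i ⟩
          S i i                          ≈⟨ S-diagonal i ⟩
          1#                             ∎

        Qᵢᵢ≈1/n : ∀ i → Q i i ≈ 1/n
        Qᵢᵢ≈1/n i = begin
          Q i i                ≈⟨ *-identityʳ _ ⟨
          Q i i * 1#           ≈⟨ *-congˡ n×1/n≈1 ⟨
          Q i i * (n ×ᴿ 1/n)   ≈⟨ ×-comm-* n _ _ ⟩
          n ×ᴿ (Q i i * 1/n)   ≈⟨ ×-assoc-* n _ _ ⟨
          (n ×ᴿ Q i i) * 1/n   ≈⟨ *-congʳ (n×Qᵢᵢ≈1 i) ⟩
          1# * 1/n             ≈⟨ *-identityˡ _ ⟩
          1/n                  ∎

        balanced⇒P≈δ-S/n : ∀ i j → P i j ≈ δ i j - 1/n * S i j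
        balanced⇒P≈δ-S/n i j = begin
          P i j                     ≈⟨ //-rightDividesʳ (Q i j) (P i j) ⟨
          (P i j + Q i j) - Q i j   ≈⟨ +-cong (trans (+-comm _ _) (Q+P i j))
                                         (-‿cong (trans (Q≈Qᵢᵢ*S i j) (*-congʳ (Qᵢᵢ≈1/n i)))) ⟩
          δ i j - 1/n * S i j       ∎

-- Real numbers

open import Defs
open ≡ using (refl; sym; trans; cong; cong₂; subst; subst₂)
open +-*-Solver using (solve; _:+_; _:*_; _:-_; :-_; _:=_; con)

p≤∣p∣ : ∀ p → p ℚ.≤ ℚ.∣ p ∣
p≤∣p∣ p with ℚₚ.≤-total 0ℚ p
... | inj₁ 0≤p = ℚₚ.≤-reflexive (sym (ℚₚ.0≤p⇒∣p∣≡p 0≤p))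
... | inj₂ p≤0 = ℚₚ.≤-trans p≤0 (ℚₚ.0≤∣p∣ p)

0≤p*p : ∀ p → 0ℚ ℚ.≤ p ℚ.* p
0≤p*p p = subst (0ℚ ℚ.≤_) eq (ℚₚ.nonNegative⁻¹ _ {{ℚₚ.nonNeg*nonNeg⇒nonNeg ℚ.∣ p ∣ {{i}} ℚ.∣ p ∣ {{i}}}})
  where
  i : ℚ.NonNegative ℚ.∣ p ∣
  i = ℚₚ.∣-∣-nonNeg p
  eq : ℚ.∣ p ∣ ℚ.* ℚ.∣ p ∣ ≡ p ℚ.* p
  eq with ℚₚ.∣p∣≡p∨∣p∣≡-p p
  ... | inj₁ e = cong₂ ℚ._*_ e e
  ... | inj₂ e = trans (cong₂ ℚ._*_ e e)
    (solve 1 (λ a → (:- a) :* (:- a) := a :* a) refl p)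

*-pos : ∀ {p q} → 0ℚ ℚ.< p → 0ℚ ℚ.< q → 0ℚ ℚ.< p ℚ.* q
*-pos {p} {q} 0<p 0<q = ℚₚ.positive⁻¹ _ {{ℚₚ.pos*pos⇒pos p {{ℚ.positive 0<p}} q {{ℚ.positive 0<q}}}}

*-mono-≤-nonNeg : ∀ {p q r s} → 0ℚ ℚ.≤ p → p ℚ.≤ q → 0ℚ ℚ.≤ r → r ℚ.≤ s → p ℚ.* r ℚ.≤ q ℚ.* s
*-mono-≤-nonNeg {p} {q} {r} {s} 0≤p p≤q 0≤r r≤s = ℚₚ.≤-trans
  (ℚₚ.*-monoʳ-≤-nonNeg r {{ℚ.nonNegative 0≤r}} p≤q)
  (ℚₚ.*-monoˡ-≤-nonNeg q {{ℚ.nonNegative (ℚₚ.≤-trans 0≤p p≤q)}} r≤s)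

-- `x ≈ᴿ y` unfolds to `Null` of the difference sequence. Equalities of reals are therefore proved
-- by rewriting such a difference, with the rational solver, as a combination of null sequences.
Null : (ℕ → ℚ) → Set
Null u = ∀ ε → 0ℚ ℚ.< ε → ∃[ K ] (∀ n → K ≤ n → ℚ.∣ u n ∣ ℚ.< ε)

null-resp : ∀ {u v} → (∀ n → u n ≡ v n) → Null u → Null v
null-resp eq nu ε 0<ε with nu ε 0<ε
... | K , h = K , λ n K≤n → subst (λ t → ℚ.∣ t ∣ ℚ.< ε) (eq n) (h n K≤n)

null-0 : ∀ {u} → (∀ n → u n ≡ 0ℚ) → Null u
null-0 eq ε 0<ε = 0 , λ n _ → subst (λ t → ℚ.∣ t ∣ ℚ.< ε) (sym (eq n)) 0<ε

null-+ : ∀ {u v} → Null u → Null v → Null (λ n → u n ℚ.+ v n)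
null-+ {u} {v} nu nv ε 0<ε with nu _ (half-pos 0<ε) | nv _ (half-pos 0<ε)
... | K , h | L , h′ = K ⊔ L , λ n p → subst (ℚ.∣ u n ℚ.+ v n ∣ ℚ.<_) (half+half ε)
  (ℚₚ.≤-<-trans (ℚₚ.∣p+q∣≤∣p∣+∣q∣ (u n) (v n))
    (ℚₚ.+-mono-< (h n (ℕₚ.m⊔n≤o⇒m≤o K L p)) (h′ n (ℕₚ.m⊔n≤o⇒n≤o K L p))))

null-neg : ∀ {u} → Null u → Null (λ n → ℚ.- u n)
null-neg {u} nu ε 0<ε with nu ε 0<ε
... | K , h = K , λ n K≤n → subst (ℚ._< ε) (sym (ℚₚ.∣-p∣≡∣p∣ (u n))) (h n K≤n)

null-* : ∀ x {u} → Null u → Null (λ n → seq x n ℚ.* u n)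
null-* x {u} nu ε 0<ε with eventually-bounded {seq x} (cauchy x)
... | B , 0<B , K , x<B with scale 0<B 0<ε
... | δ , 0<δ , Bδ≡ε with nu δ 0<δ
... | L , h = K ⊔ L , λ n p → subst (ℚ.∣ seq x n ℚ.* u n ∣ ℚ.<_) Bδ≡ε
  (abs-product-< {seq x n} 0<B (x<B n (ℕₚ.m⊔n≤o⇒m≤o K L p)) (h n (ℕₚ.m⊔n≤o⇒n≤o K L p)))

≗⇒≈ᴿ : ∀ {x y} → (∀ n → seq x n ≡ seq y n) → x ≈ᴿ y
≗⇒≈ᴿ {x} {y} eq = null-0 λ n →
  trans (cong (ℚ._- seq y n) (eq n)) (ℚₚ.+-inverseʳ (seq y n))

≈ᴿ-refl : ∀ {x} → x ≈ᴿ x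
≈ᴿ-refl {x} = ≗⇒≈ᴿ {x} {x} λ _ → refl

≈ᴿ-sym : ∀ {x y} → x ≈ᴿ y → y ≈ᴿ x
≈ᴿ-sym {x} {y} x≈y = null-resp
  (λ n → solve 2 (λ a b → :- (a :- b) := b :- a) refl (seq x n) (seq y n))
  (null-neg x≈y)

≈ᴿ-trans : ∀ {x y z} → x ≈ᴿ y → y ≈ᴿ z → x ≈ᴿ z
≈ᴿ-trans {x} {y} {z} x≈y y≈z = null-resp
  (λ n → solve 3 (λ a b c → (a :- b) :+ (b :- c) := a :- c) refl (seq x n) (seq y n) (seq z n))
  (null-+ x≈y y≈z)

+ᴿ-cong : ∀ {x x′ y y′} → x ≈ᴿ x′ → y ≈ᴿ y′ → x +ᴿ y ≈ᴿ x′ +ᴿ y′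
+ᴿ-cong {x} {x′} {y} {y′} p q = null-resp
  (λ n → solve 4 (λ a b c d → (a :- b) :+ (c :- d) := (a :+ c) :- (b :+ d)) refl
    (seq x n) (seq x′ n) (seq y n) (seq y′ n))
  (null-+ p q)

-ᴿ-cong : ∀ {x y} → x ≈ᴿ y → -ᴿ x ≈ᴿ -ᴿ y
-ᴿ-cong {x} {y} p = null-resp
  (λ n → solve 2 (λ a b → :- (a :- b) := (:- a) :- (:- b)) refl (seq x n) (seq y n))
  (null-neg p)

*ᴿ-cong : ∀ {x x′ y y′} → x ≈ᴿ x′ → y ≈ᴿ y′ → x *ᴿ y ≈ᴿ x′ *ᴿ y′
*ᴿ-cong {x} {x′} {y} {y′} p q = null-resp
  (λ n → solve 4 (λ a b c d → d :* (a :- b) :+ a :* (c :- d) := a :* c :- b :* d) refl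
    (seq x n) (seq x′ n) (seq y n) (seq y′ n))
  (null-+ (null-* y′ p) (null-* x q))

≈0⇒null : ∀ {x} → x ≈ᴿ 0ᴿ → Null (seq x)
≈0⇒null {x} = null-resp (λ n → ℚₚ.+-identityʳ (seq x n))

null⇒≈0 : ∀ {x} → Null (seq x) → x ≈ᴿ 0ᴿ
null⇒≈0 {x} = null-resp (λ n → sym (ℚₚ.+-identityʳ (seq x n)))

pos-resp : ∀ {x y} → x ≈ᴿ y → 0ᴿ <ᴿ x → 0ᴿ <ᴿ y
pos-resp {x} {y} x≈y (ε , 0<ε , K , h) with x≈y _ (half-pos 0<ε)
... | L , h′ = ½ ℚ.* ε , half-pos 0<ε , K ⊔ L , λ n p → subst₂ ℚ._<_
  (solve 1 (λ e → (con 0ℚ :+ e) :- con ½ :* e := con 0ℚ :+ con ½ :* e) refl ε)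
  (solve 2 (λ a b → a :- (a :- b) := b) refl (seq x n) (seq y n))
  (ℚₚ.+-mono-< (h n (ℕₚ.m⊔n≤o⇒m≤o K L p))
    (ℚₚ.neg-antimono-< (ℚₚ.≤-<-trans (p≤∣p∣ _) (h′ n (ℕₚ.m⊔n≤o⇒n≤o K L p)))))

pos⇒≉0 : ∀ {x} → 0ᴿ <ᴿ x → ¬ (x ≈ᴿ 0ᴿ)
pos⇒≉0 {x} (ε , 0<ε , K , h) x≈0 with ≈0⇒null {x} x≈0 ε 0<ε
... | L , h′ = ℚₚ.<-asym (subst (ℚ._< seq x n) (ℚₚ.+-identityˡ ε) (h n (ℕₚ.m≤m⊔n K L)))
    (ℚₚ.≤-<-trans (p≤∣p∣ _) (h′ n (ℕₚ.m≤n⊔m K L)))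
  where n = K ⊔ L

pos-+ : ∀ {x y} → 0ᴿ <ᴿ x → 0ᴿ <ᴿ y → 0ᴿ <ᴿ x +ᴿ y
pos-+ {x} {y} (ε , 0<ε , K , h) (δ , 0<δ , L , h′) =
  ε ℚ.+ δ , ℚₚ.+-mono-< 0<ε 0<δ , K ⊔ L , λ n p → subst (ℚ._< seq x n ℚ.+ seq y n)
    (solve 2 (λ a b → (con 0ℚ :+ a) :+ (con 0ℚ :+ b) := con 0ℚ :+ (a :+ b)) refl ε δ)
    (ℚₚ.+-mono-< (h n (ℕₚ.m⊔n≤o⇒m≤o K L p)) (h′ n (ℕₚ.m⊔n≤o⇒n≤o K L p)))

pos-* : ∀ {x y} → 0ᴿ <ᴿ x → 0ᴿ <ᴿ y → 0ᴿ <ᴿ x *ᴿ y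
pos-* {x} {y} (ε , 0<ε , K , h) (δ , 0<δ , L , h′) =
  ε ℚ.* δ , *-pos 0<ε 0<δ , K ⊔ L , λ n p →
    let ε<x = subst (ℚ._< seq x n) (ℚₚ.+-identityˡ ε) (h n (ℕₚ.m⊔n≤o⇒m≤o K L p))
        δ<y = subst (ℚ._< seq y n) (ℚₚ.+-identityˡ δ) (h′ n (ℕₚ.m⊔n≤o⇒n≤o K L p))
    in subst (ℚ._< seq x n ℚ.* seq y n) (sym (ℚₚ.+-identityˡ (ε ℚ.* δ)))
      (ℚₚ.<-≤-trans (ℚₚ.*-monoˡ-<-pos δ {{ℚ.positive 0<δ}} ε<x)
        (ℚₚ.*-monoˡ-≤-nonNeg (seq x n)
          {{ℚ.nonNegative (ℚₚ.<⇒≤ (ℚₚ.<-trans 0<ε ε<x))}} (ℚₚ.<⇒≤ δ<y)))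

pos-+-square : ∀ {x} y → 0ᴿ <ᴿ x → 0ᴿ <ᴿ x +ᴿ y *ᴿ y
pos-+-square {x} y (ε , 0<ε , K , h) = ε , 0<ε , K , λ n p →
  subst (ℚ._< seq x n ℚ.+ seq y n ℚ.* seq y n) (ℚₚ.+-identityʳ (0ℚ ℚ.+ ε))
    (ℚₚ.+-mono-<-≤ (h n p) (0≤p*p (seq y n)))

neg⇒pos-neg : ∀ {x} → x <ᴿ 0ᴿ → 0ᴿ <ᴿ -ᴿ x
neg⇒pos-neg {x} (ε , 0<ε , K , h) = ε , 0<ε , K , λ n p → subst₂ ℚ._<_
  (solve 2 (λ a e → (a :+ e) :- a := con 0ℚ :+ e) refl (seq x n) ε)
  (ℚₚ.+-identityˡ (ℚ.- seq x n))
  (ℚₚ.+-monoˡ-< (ℚ.- seq x n) (h n p))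

pos-neg⇒neg : ∀ {x} → 0ᴿ <ᴿ -ᴿ x → x <ᴿ 0ᴿ
pos-neg⇒neg {x} (ε , 0<ε , K , h) = ε , 0<ε , K , λ n p → subst₂ ℚ._<_
  (solve 2 (λ a e → (con 0ℚ :+ e) :+ a := a :+ e) refl (seq x n) ε)
  (ℚₚ.+-inverseˡ (seq x n))
  (ℚₚ.+-monoˡ-< (seq x n) (h n p))

-- Comparison of rationals is decidable, so one term of the sequence can be tested against ½ε. A
-- large term would give the real a sign, against the hypotheses; a small one keeps the tail below
-- ε. Equality is thereby stable under double negation.
≮≯⇒≈0 : ∀ {x} → ¬ (0ᴿ <ᴿ x) → ¬ (0ᴿ <ᴿ -ᴿ x) → x ≈ᴿ 0ᴿ
≮≯⇒≈0 {x} ≯0 ≮0 = null⇒≈0 {x} go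
  where
  -- A tail within ¼ε of seq x K, where ∣ seq x K ∣ ≥ ½ε, stays ¼ε away from 0.
  away : ∀ (y : ℝ) ε → 0ℚ ℚ.< ε → ∀ K → ½ ℚ.* ε ℚ.≤ seq y K →
    (∀ n → K ≤ n → ℚ.∣ seq y K ℚ.- seq y n ∣ ℚ.< ½ ℚ.* (½ ℚ.* ε)) → 0ᴿ <ᴿ y
  away y ε 0<ε K big near = δ , half-pos (half-pos 0<ε) , K , λ n p → subst₂ ℚ._<_
    (solve 1 (λ e → con ½ :* e :- con ½ :* (con ½ :* e) := con 0ℚ :+ con ½ :* (con ½ :* e)) refl ε)
    (solve 2 (λ a b → a :- (a :- b) := b) refl (seq y K) (seq y n))
    (ℚₚ.+-mono-≤-< big (ℚₚ.neg-antimono-< (ℚₚ.≤-<-trans (p≤∣p∣ _) (near n p))))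
    where δ = ½ ℚ.* (½ ℚ.* ε)

  go : Null (seq x)
  -- Precision ¼ε suits both outcomes: ½ε - ¼ε is still positive, and ¼ε + ½ε is still below ε.
  go ε 0<ε with cauchy x _ (half-pos (half-pos 0<ε))
  ... | K , h with seq x K ℚₚ.<? ½ ℚ.* ε | ℚ.- seq x K ℚₚ.<? ½ ℚ.* ε
  ... | no ≮ | _ = ⊥-elim (≯0 (away x ε 0<ε K (ℚₚ.≮⇒≥ ≮) λ n p → h K n ℕₚ.≤-refl p))
  ... | yes _ | no ≮ = ⊥-elim (≮0 (away (-ᴿ x) ε 0<ε K (ℚₚ.≮⇒≥ ≮) λ n p →
    subst (ℚ._< ½ ℚ.* (½ ℚ.* ε))
      (trans (sym (ℚₚ.∣-p∣≡∣p∣ (seq x K ℚ.- seq x n)))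
        (cong ℚ.∣_∣ (ℚₚ.neg-distrib-+ (seq x K) (ℚ.- seq x n))))
      (h K n ℕₚ.≤-refl p)))
  ... | yes < | yes <′ = K , λ n p → subst₂ ℚ._<_
    (cong ℚ.∣_∣ (solve 2 (λ a b → (a :- b) :+ b := a) refl (seq x n) (seq x K)))
    (half+half ε)
    (ℚₚ.≤-<-trans (ℚₚ.∣p+q∣≤∣p∣+∣q∣ (seq x n ℚ.- seq x K) (seq x K))
      (ℚₚ.+-mono-< (ℚₚ.<-trans (h n K p ℕₚ.≤-refl) half-half<half) (abs< (ℚₚ.∣p∣≡p∨∣p∣≡-p (seq x K)))))
    where
    half-half<half : ½ ℚ.* (½ ℚ.* ε) ℚ.< ½ ℚ.* ε
    half-half<half = subst₂ ℚ._<_ (ℚₚ.+-identityʳ _) (half+half (½ ℚ.* ε))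
      (ℚₚ.+-monoʳ-< (½ ℚ.* (½ ℚ.* ε)) (half-pos (half-pos 0<ε)))
    abs< : (ℚ.∣ seq x K ∣ ≡ seq x K) ⊎ (ℚ.∣ seq x K ∣ ≡ ℚ.- seq x K) → ℚ.∣ seq x K ∣ ℚ.< ½ ℚ.* ε
    abs< (inj₁ e) = subst (ℚ._< ½ ℚ.* ε) (sym e) <
    abs< (inj₂ e) = subst (ℚ._< ½ ℚ.* ε) (sym e) <′

-- Eventually `x` exceeds a fixed δ, so precision δε for the product gives precision ε for `y`.
pos*y≈0⇒y≈0ᴿ : ∀ {x y} → 0ᴿ <ᴿ x → x *ᴿ y ≈ᴿ 0ᴿ → y ≈ᴿ 0ᴿ
pos*y≈0⇒y≈0ᴿ {x} {y} (δ , 0<δ , K , h) xy≈0 = null⇒≈0 {y} go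
  where
  go : Null (seq y)
  go ε 0<ε with ≈0⇒null {x *ᴿ y} xy≈0 (δ ℚ.* ε) (*-pos 0<δ 0<ε)
  ... | L , h′ = K ⊔ L , below
    where
    below : ∀ n → K ⊔ L ≤ n → ℚ.∣ seq y n ∣ ℚ.< ε
    below n p with ℚ.∣ seq y n ∣ ℚₚ.<? ε
    ... | yes < = <
    ... | no ≮ = ⊥-elim (ℚₚ.<-irrefl refl (ℚₚ.<-≤-trans (h′ n (ℕₚ.m⊔n≤o⇒n≤o K L p))
      (subst (δ ℚ.* ε ℚ.≤_) (sym (ℚₚ.∣p*q∣≡∣p∣*∣q∣ (seq x n) (seq y n)))
        (*-mono-≤-nonNeg (ℚₚ.<⇒≤ 0<δ)
          (ℚₚ.≤-trans (ℚₚ.<⇒≤ (subst (ℚ._< seq x n) (ℚₚ.+-identityˡ δ) (h n (ℕₚ.m⊔n≤o⇒m≤o K L p))))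
            (p≤∣p∣ (seq x n)))
          (ℚₚ.<⇒≤ 0<ε) (ℚₚ.≮⇒≥ ≮)))))

-- That `y` is not zero yields no lower bound on `y`, so `x` is tested instead: either sign of `x`
-- would make it cancellable and force `y ≈ᴿ 0ᴿ`.
xy≈0⇒x≈0ᴿ : ∀ {x y} → x *ᴿ y ≈ᴿ 0ᴿ → ¬ (y ≈ᴿ 0ᴿ) → x ≈ᴿ 0ᴿ
xy≈0⇒x≈0ᴿ {x} {y} xy≈0 y≉0 = ≮≯⇒≈0 {x}
  (λ 0<x → y≉0 (pos*y≈0⇒y≈0ᴿ {x} {y} 0<x xy≈0))
  (λ 0<-x → y≉0 (pos*y≈0⇒y≈0ᴿ { -ᴿ x} {y} 0<-x (null-resp
    (λ n → solve 2 (λ a b → :- (a :* b :- con 0ℚ) := (:- a) :* b :- con 0ℚ) refl (seq x n) (seq y n))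
    (null-neg xy≈0))))

-- The sum of squares dominates the square of `x` termwise, so precision ε² for the sum gives ε for
-- `x`.
squares≈0⇒≈0 : ∀ {x y} → x *ᴿ x +ᴿ y *ᴿ y ≈ᴿ 0ᴿ → x ≈ᴿ 0ᴿ
squares≈0⇒≈0 {x} {y} eq = null⇒≈0 {x} go
  where
  go : Null (seq x)
  go ε 0<ε with ≈0⇒null {x *ᴿ x +ᴿ y *ᴿ y} eq (ε ℚ.* ε) (*-pos 0<ε 0<ε)
  ... | K , h = K , below
    where
    below : ∀ n → K ≤ n → ℚ.∣ seq x n ∣ ℚ.< ε
    below n p with ℚ.∣ seq x n ∣ ℚₚ.<? ε
    ... | yes < = <
    ... | no ≮ = ⊥-elim (ℚₚ.<-irrefl refl (ℚₚ.<-≤-trans (h n p)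
      (ℚₚ.≤-trans (*-mono-≤-nonNeg (ℚₚ.<⇒≤ 0<ε) (ℚₚ.≮⇒≥ ≮) (ℚₚ.<⇒≤ 0<ε) (ℚₚ.≮⇒≥ ≮))
      (ℚₚ.≤-trans (ℚₚ.≤-reflexive (trans (sym (ℚₚ.∣p*q∣≡∣p∣*∣q∣ (seq x n) (seq x n))) (ℚₚ.0≤p⇒∣p∣≡p (0≤p*p (seq x n)))))
      (ℚₚ.≤-trans (subst (ℚ._≤ seq x n ℚ.* seq x n ℚ.+ seq y n ℚ.* seq y n) (ℚₚ.+-identityʳ _)
          (ℚₚ.+-monoʳ-≤ (seq x n ℚ.* seq x n) (0≤p*p (seq y n))))
        (p≤∣p∣ _))))))

-- Complex numbers

≗⇒≈ : ∀ {z w} → (∀ n → seq (Re z) n ≡ seq (Re w) n) → (∀ n → seq (Im z) n ≡ seq (Im w) n) → z ≈ w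
≗⇒≈ {z} {w} re im = ≗⇒≈ᴿ {Re z} {Re w} re , ≗⇒≈ᴿ {Im z} {Im w} im

≈-refl : ∀ {z} → z ≈ z
≈-refl {z} = ≈ᴿ-refl {Re z} , ≈ᴿ-refl {Im z}

≈-sym : ∀ {z w} → z ≈ w → w ≈ z
≈-sym {z} {w} (p , q) = ≈ᴿ-sym {Re z} {Re w} p , ≈ᴿ-sym {Im z} {Im w} q

≈-trans : ∀ {z w v} → z ≈ w → w ≈ v → z ≈ v
≈-trans {z} {w} {v} (p , q) (p′ , q′) =
  ≈ᴿ-trans {Re z} {Re w} {Re v} p p′ , ≈ᴿ-trans {Im z} {Im w} {Im v} q q′

+-cong : ∀ {z z′ w w′} → z ≈ z′ → w ≈ w′ → z + w ≈ z′ + w′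
+-cong {z} {z′} {w} {w′} (p , q) (p′ , q′) =
  +ᴿ-cong {Re z} {Re z′} {Re w} {Re w′} p p′ , +ᴿ-cong {Im z} {Im z′} {Im w} {Im w′} q q′

-‿cong : ∀ {z w} → z ≈ w → - z ≈ - w
-‿cong {z} {w} (p , q) = -ᴿ-cong {Re z} {Re w} p , -ᴿ-cong {Im z} {Im w} q

conj-cong : ∀ {z w} → z ≈ w → conj z ≈ conj w
conj-cong {z} {w} (p , q) = p , -ᴿ-cong {Im z} {Im w} q

*-cong : ∀ {z z′ w w′} → z ≈ z′ → w ≈ w′ → z * w ≈ z′ * w′
*-cong {a +i b} {a′ +i b′} {c +i d} {c′ +i d′} (p , q) (p′ , q′) =
  +ᴿ-cong {a *ᴿ c} {a′ *ᴿ c′} {(-ᴿ (b *ᴿ d))} {(-ᴿ (b′ *ᴿ d′))} (*ᴿ-cong {a} {a′} {c} {c′} p p′)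
    (-ᴿ-cong {b *ᴿ d} {b′ *ᴿ d′} (*ᴿ-cong {b} {b′} {d} {d′} q q′)) ,
  +ᴿ-cong {a *ᴿ d} {a′ *ᴿ d′} {b *ᴿ c} {b′ *ᴿ c′} (*ᴿ-cong {a} {a′} {d} {d′} p q′)
    (*ᴿ-cong {b} {b′} {c} {c′} q p′)

-- Apart from equivalence and congruence, every axiom already holds term by term for the
-- representing rational sequences.
ℂ-commutativeRing : CommutativeRing 0ℓ 0ℓ
ℂ-commutativeRing = record
  { Carrier = ℂ ; _≈_ = _≈_ ; _+_ = _+_ ; _*_ = _*_ ; -_ = -_ ; 0# = 0ℂ ; 1# = 1ℂ
  ; isCommutativeRing = record
    { isRing = record
      { +-isAbelianGroup = record
        { isGroup = record
          { isMonoid = record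
            { isSemigroup = record
              { isMagma = record
                { isEquivalence = record
                  { refl = λ {z} → ≈-refl {z}
                  ; sym = λ {z} {w} → ≈-sym {z} {w}
                  ; trans = λ {z} {w} {v} → ≈-trans {z} {w} {v} }
                ; ∙-cong = λ {z} {z′} {w} {w′} → +-cong {z} {z′} {w} {w′} }
              ; assoc = λ z w v → ≗⇒≈ {(z + w) + v} {z + (w + v)}
                  (λ n → ℚₚ.+-assoc (seq (Re z) n) (seq (Re w) n) (seq (Re v) n))
                  (λ n → ℚₚ.+-assoc (seq (Im z) n) (seq (Im w) n) (seq (Im v) n)) }
            ; identity =
                (λ z → ≗⇒≈ {0ℂ + z} {z} (λ n → ℚₚ.+-identityˡ (seq (Re z) n)) (λ n → ℚₚ.+-identityˡ (seq (Im z) n)))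
              , (λ z → ≗⇒≈ {z + 0ℂ} {z} (λ n → ℚₚ.+-identityʳ (seq (Re z) n)) (λ n → ℚₚ.+-identityʳ (seq (Im z) n))) }
          ; inverse =
              (λ z → ≗⇒≈ { - z + z} {0ℂ} (λ n → ℚₚ.+-inverseˡ (seq (Re z) n)) (λ n → ℚₚ.+-inverseˡ (seq (Im z) n)))
            , (λ z → ≗⇒≈ {z - z} {0ℂ} (λ n → ℚₚ.+-inverseʳ (seq (Re z) n)) (λ n → ℚₚ.+-inverseʳ (seq (Im z) n)))
          ; ⁻¹-cong = λ {z} {w} → -‿cong {z} {w} }
        ; comm = λ z w → ≗⇒≈ {z + w} {w + z}
            (λ n → ℚₚ.+-comm (seq (Re z) n) (seq (Re w) n)) (λ n → ℚₚ.+-comm (seq (Im z) n) (seq (Im w) n)) }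
      ; *-cong = λ {z} {z′} {w} {w′} → *-cong {z} {z′} {w} {w′}
      ; *-assoc = λ z w v → ≗⇒≈ {(z * w) * v} {z * (w * v)}
          (λ n → solve 6 (λ a b c d e f → (a :* c :- b :* d) :* e :- (a :* d :+ b :* c) :* f
                                       := a :* (c :* e :- d :* f) :- b :* (c :* f :+ d :* e)) refl
            (seq (Re z) n) (seq (Im z) n) (seq (Re w) n) (seq (Im w) n) (seq (Re v) n) (seq (Im v) n))
          (λ n → solve 6 (λ a b c d e f → (a :* c :- b :* d) :* f :+ (a :* d :+ b :* c) :* e
                                       := a :* (c :* f :+ d :* e) :+ b :* (c :* e :- d :* f)) refl
            (seq (Re z) n) (seq (Im z) n) (seq (Re w) n) (seq (Im w) n) (seq (Re v) n) (seq (Im v) n))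
      ; *-identity =
          (λ z → ≗⇒≈ {1ℂ * z} {z}
            (λ n → solve 2 (λ a b → con 1ℚ :* a :- con 0ℚ :* b := a) refl (seq (Re z) n) (seq (Im z) n))
            (λ n → solve 2 (λ a b → con 1ℚ :* b :+ con 0ℚ :* a := b) refl (seq (Re z) n) (seq (Im z) n)))
        , (λ z → ≗⇒≈ {z * 1ℂ} {z}
            (λ n → solve 2 (λ a b → a :* con 1ℚ :- b :* con 0ℚ := a) refl (seq (Re z) n) (seq (Im z) n))
            (λ n → solve 2 (λ a b → a :* con 0ℚ :+ b :* con 1ℚ := b) refl (seq (Re z) n) (seq (Im z) n)))
      ; distrib =
          (λ z w v → ≗⇒≈ {z * (w + v)} {z * w + z * v}
            (λ n → solve 6 (λ a b c d e f → a :* (c :+ e) :- b :* (d :+ f)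
                                         := (a :* c :- b :* d) :+ (a :* e :- b :* f)) refl
              (seq (Re z) n) (seq (Im z) n) (seq (Re w) n) (seq (Im w) n) (seq (Re v) n) (seq (Im v) n))
            (λ n → solve 6 (λ a b c d e f → a :* (d :+ f) :+ b :* (c :+ e)
                                         := (a :* d :+ b :* c) :+ (a :* f :+ b :* e)) refl
              (seq (Re z) n) (seq (Im z) n) (seq (Re w) n) (seq (Im w) n) (seq (Re v) n) (seq (Im v) n)))
        , (λ z w v → ≗⇒≈ {(w + v) * z} {w * z + v * z}
            (λ n → solve 6 (λ a b c d e f → (c :+ e) :* a :- (d :+ f) :* b
                                         := (c :* a :- d :* b) :+ (e :* a :- f :* b)) refl
              (seq (Re z) n) (seq (Im z) n) (seq (Re w) n) (seq (Im w) n) (seq (Re v) n) (seq (Im v) n))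
            (λ n → solve 6 (λ a b c d e f → (c :+ e) :* b :+ (d :+ f) :* a
                                         := (c :* b :+ d :* a) :+ (e :* b :+ f :* a)) refl
              (seq (Re z) n) (seq (Im z) n) (seq (Re w) n) (seq (Im w) n) (seq (Re v) n) (seq (Im v) n))) }
    ; *-comm = λ z w → ≗⇒≈ {z * w} {w * z}
        (λ n → solve 4 (λ a b c d → a :* c :- b :* d := c :* a :- d :* b) refl
          (seq (Re z) n) (seq (Im z) n) (seq (Re w) n) (seq (Im w) n))
        (λ n → solve 4 (λ a b c d → a :* d :+ b :* c := c :* b :+ d :* a) refl
          (seq (Re z) n) (seq (Im z) n) (seq (Re w) n) (seq (Im w) n)) } }

conj-* : ∀ z w → conj (z * w) ≈ conj z * conj w
conj-* z w = ≗⇒≈ {conj (z * w)} {conj z * conj w}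
  (λ n → solve 4 (λ a b c d → a :* c :- b :* d := a :* c :- (:- b) :* (:- d)) refl
    (seq (Re z) n) (seq (Im z) n) (seq (Re w) n) (seq (Im w) n))
  (λ n → solve 4 (λ a b c d → :- (a :* d :+ b :* c) := a :* (:- d) :+ (:- b) :* c) refl
    (seq (Re z) n) (seq (Im z) n) (seq (Re w) n) (seq (Im w) n))

conj-neg : ∀ z → conj (- z) ≈ - conj z
conj-neg z = ≈-refl { - conj z}

conj-involutive : ∀ z → conj (conj z) ≈ z
conj-involutive z = ≗⇒≈ {conj (conj z)} {z} (λ _ → refl)
  (λ n → solve 1 (λ a → :- (:- a) := a) refl (seq (Im z) n))

∣_∣² : ℂ → ℝ
∣ z ∣² = Re z *ᴿ Re z +ᴿ Im z *ᴿ Im z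

∣∣²≈0⇒≈0 : ∀ {z} → ∣ z ∣² ≈ᴿ 0ᴿ → z ≈ 0ℂ
∣∣²≈0⇒≈0 {a +i b} eq = squares≈0⇒≈0 {a} {b} eq , squares≈0⇒≈0 {b} {a}
  (≈ᴿ-trans {b *ᴿ b +ᴿ a *ᴿ a} {a *ᴿ a +ᴿ b *ᴿ b} {0ᴿ}
    (≗⇒≈ᴿ {b *ᴿ b +ᴿ a *ᴿ a} {a *ᴿ a +ᴿ b *ᴿ b} (λ n → ℚₚ.+-comm (seq b n ℚ.* seq b n) (seq a n ℚ.* seq a n))) eq)

≈0⇒∣∣²≈0 : ∀ {z} → z ≈ 0ℂ → ∣ z ∣² ≈ᴿ 0ᴿ
≈0⇒∣∣²≈0 {a +i b} (p , q) = null-resp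
  (λ n → solve 2 (λ a b → a :* (a :- con 0ℚ) :+ b :* (b :- con 0ℚ) := (a :* a :+ b :* b) :- con 0ℚ) refl (seq a n) (seq b n))
  (null-+ (null-* a p) (null-* b q))

∣∣²-* : ∀ z w → ∣ z * w ∣² ≈ᴿ ∣ z ∣² *ᴿ ∣ w ∣²
∣∣²-* z w = ≗⇒≈ᴿ {∣ z * w ∣²} {∣ z ∣² *ᴿ ∣ w ∣²} λ n → solve 4
  (λ a b c d → (a :* c :- b :* d) :* (a :* c :- b :* d) :+ (a :* d :+ b :* c) :* (a :* d :+ b :* c)
    := (a :* a :+ b :* b) :* (c :* c :+ d :* d)) refl
  (seq (Re z) n) (seq (Im z) n) (seq (Re w) n) (seq (Im w) n)

-- Squared moduli are multiplicative and vanish only at zero, which reduces the claim to the reals.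
zw≈0⇒z≈0 : ∀ z w → z * w ≈ 0ℂ → ¬ (w ≈ 0ℂ) → z ≈ 0ℂ
zw≈0⇒z≈0 z w zw≈0 w≉0 = ∣∣²≈0⇒≈0 {z} (xy≈0⇒x≈0ᴿ {∣ z ∣²} {∣ w ∣²}
  (≈ᴿ-trans {∣ z ∣² *ᴿ ∣ w ∣²} {∣ z * w ∣²} {0ᴿ}
    (≈ᴿ-sym {∣ z * w ∣²} {∣ z ∣² *ᴿ ∣ w ∣²} (∣∣²-* z w)) (≈0⇒∣∣²≈0 {z * w} zw≈0))
  (λ eq → w≉0 (∣∣²≈0⇒≈0 {w} eq)))

z*conj : ∀ z → z * conj z ≈ real ∣ z ∣²
z*conj z = ≗⇒≈ {z * conj z} {real ∣ z ∣²}
  (λ n → solve 2 (λ a b → a :* a :- b :* (:- b) := a :* a :+ b :* b) refl (seq (Re z) n) (seq (Im z) n))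
  (λ n → solve 2 (λ a b → a :* (:- b) :+ b :* a := con 0ℚ) refl (seq (Re z) n) (seq (Im z) n))

0<1ᴿ : 0ᴿ <ᴿ 1ᴿ
0<1ᴿ = ½ , ℚₚ.positive⁻¹ ½ , 0 , λ _ _ → subst (ℚ._< 1ℚ) (sym (ℚₚ.+-identityˡ ½)) ½<1
  where
  ½<1 : ½ ℚ.< 1ℚ
  ½<1 = ℚₚ.+-monoʳ-< ½ (ℚₚ.positive⁻¹ ½)

1≉0 : ¬ (1ℂ ≈ 0ℂ)
1≉0 (re , _) = pos⇒≉0 {1ᴿ} 0<1ᴿ re

ℂ-isConjugationDomain : IsConjugationDomain ℂ-commutativeRing conj
ℂ-isConjugationDomain = record
  { 1≉0 = 1≉0
  ; xy≈0⇒x≈0 = zw≈0⇒z≈0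
  ; conj-cong = λ {z} {w} → conj-cong {z} {w}
  ; conj-+ = λ z w → ≗⇒≈ {conj (z + w)} {conj z + conj w} (λ _ → refl)
      (λ n → ℚₚ.neg-distrib-+ (seq (Im z) n) (seq (Im w) n))
  ; conj-* = conj-*
  ; conj-neg = conj-neg
  ; conj-0 = ≈-refl {0ℂ}
  ; conj-1 = ≈-refl {1ℂ}
  ; conj-involutive = conj-involutive }

open Domain ℂ-commutativeRing conj ℂ-isConjugationDomain
open CommutativeRing ℂ-commutativeRing using (setoid; *-identityˡ; *-identityʳ; *-congˡ; semiring)
open SemiringMult semiring using () renaming (_×_ to _×ᶜ_)
open SetoidReasoning setoid

∈ℝ⁺-resp : ∀ {z w} → z ≈ w → z ∈ℝ⁺ → w ∈ℝ⁺
∈ℝ⁺-resp {z} {w} (re , im) (im0 , pos) =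
  ≈ᴿ-trans {Im w} {Im z} {0ᴿ} (≈ᴿ-sym {Im z} {Im w} im) im0 , pos-resp {Re z} {Re w} re pos

∈ℝ⁺-* : ∀ {z w} → z ∈ℝ⁺ → w ∈ℝ⁺ → (z * w) ∈ℝ⁺
∈ℝ⁺-* {z} {w} (imz , posz) (imw , posw) = ∈ℝ⁺-resp {real (Re z *ᴿ Re w)} {z * w}
  (≈-trans {real (Re z *ᴿ Re w)} {real (Re z) * real (Re w)} {z * w}
    (≗⇒≈ {real (Re z *ᴿ Re w)} {real (Re z) * real (Re w)}
      (λ n → solve 2 (λ a b → a :* b := a :* b :- con 0ℚ :* con 0ℚ) refl (seq (Re z) n) (seq (Re w) n))
      (λ n → solve 2 (λ a b → con 0ℚ := a :* con 0ℚ :+ con 0ℚ :* b) refl (seq (Re z) n) (seq (Re w) n)))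
    (*-cong {real (Re z)} {z} {real (Re w)} {w}
      (≈ᴿ-refl {Re z} , ≈ᴿ-sym {Im z} {0ᴿ} imz) (≈ᴿ-refl {Re w} , ≈ᴿ-sym {Im w} {0ᴿ} imw)))
  (≈ᴿ-refl {0ᴿ} , pos-* {Re z} {Re w} posz posw)

∈ℝ⁻⇒-∈ℝ⁺ : ∀ {z} → z ∈ℝ⁻ → (- z) ∈ℝ⁺
∈ℝ⁻⇒-∈ℝ⁺ {z} (im0 , neg) = -ᴿ-cong {Im z} {0ᴿ} im0 , neg⇒pos-neg {Re z} neg

-∈ℝ⁺⇒∈ℝ⁻ : ∀ {z} → (- z) ∈ℝ⁺ → z ∈ℝ⁻
-∈ℝ⁺⇒∈ℝ⁻ {z} (im0 , pos) =
  null-resp (λ n → solve 1 (λ a → :- ((:- a) :- con 0ℚ) := a :- con 0ℚ) refl (seq (Im z) n)) (null-neg im0)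
  , pos-neg⇒neg {Re z} pos

∈ℝ⁺⇒conj≈ : ∀ {z} → z ∈ℝ⁺ → conj z ≈ z
∈ℝ⁺⇒conj≈ {z} (im0 , _) = ≈ᴿ-refl {Re z} ,
  ≈ᴿ-trans { -ᴿ Im z} {0ᴿ} {Im z} (-ᴿ-cong {Im z} {0ᴿ} im0) (≈ᴿ-sym {Im z} {0ᴿ} im0)

-- Given directly in lowest terms (the stored 0 encodes denominator 1), so that `ℚ.1/` computes on
-- `fromℕ (suc k)`.
fromℕ : ℕ → ℚ
fromℕ k = ℚ.mkℚ (+ k) 0 (Coprimality.sym (1-coprimeTo k))

fromℕ-suc : ∀ k → 1ℚ ℚ.+ fromℕ k ≡ fromℕ (suc k)
fromℕ-suc k = trans (cong (λ t → (+ 1 ℤ.+ t) ℚ./ 1) (ℤₚ.*-identityʳ (+ k))) (ℚₚ.↥p/↧p≡p (fromℕ (suc k)))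

fromℕ-inverse : ∀ n .{{_ : NonZero n}} → fromℕ n ℚ.* ((+ 1) ℚ./ n) ≡ 1ℚ
fromℕ-inverse (suc k) = trans (cong (fromℕ (suc k) ℚ.*_) (ℚₚ.↥p/↧p≡p (ℚ.1/ fromℕ (suc k))))
  (ℚₚ.*-inverseʳ (fromℕ (suc k)))

reciprocal-inverse : ∀ n .{{_ : NonZero n}} → n ×ᶜ reciprocal n ≈ 1ℂ
reciprocal-inverse n = ≗⇒≈ {n ×ᶜ reciprocal n} {1ℂ}
  (λ k → trans (re n _ k) (fromℕ-inverse n)) (im n _)
  where
  re : ∀ m q k → seq (Re (m ×ᶜ real (fromℚ q))) k ≡ fromℕ m ℚ.* q
  re zero q k = sym (ℚₚ.*-zeroˡ q)
  re (suc m) q k = trans (cong₂ ℚ._+_ (sym (ℚₚ.*-identityˡ q)) (re m q k))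
    (trans (sym (ℚₚ.*-distribʳ-+ q 1ℚ (fromℕ m))) (cong (ℚ._* q) (fromℕ-suc m)))
  im : ∀ m q k → seq (Im (m ×ᶜ real (fromℚ q))) k ≡ 0ℚ
  im zero q k = refl
  im (suc m) q k = trans (ℚₚ.+-identityˡ _) (im m q k)

even-sign : ∀ k → 2 ∣ k → (- 1ℂ) ^ k ≈ 1ℂ
even-sign zero _ = ≈-refl {1ℂ}
even-sign (suc zero) 2∣1 = contradiction (∣1⇒≡1 2∣1) λ ()
even-sign (suc (suc k)) 2∣2+k = ≈-trans {(- 1ℂ) ^ suc (suc k)} {(- 1ℂ) ^ k} {1ℂ}
  (-1*-1*x ((- 1ℂ) ^ k)) (even-sign k (∣m+n∣m⇒∣n 2∣2+k ∣-refl))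

odd-sign : ∀ k → ¬ (2 ∣ k) → (- 1ℂ) ^ k ≈ - 1ℂ
odd-sign zero 2∤0 = contradiction (2 ∣0) 2∤0
odd-sign (suc zero) _ = *-identityʳ (- 1ℂ)
odd-sign (suc (suc k)) 2∤2+k = ≈-trans {(- 1ℂ) ^ suc (suc k)} {(- 1ℂ) ^ k} { - 1ℂ}
  (-1*-1*x ((- 1ℂ) ^ k)) (odd-sign k λ 2∣k → 2∤2+k (∣m∣n⇒∣m+n ∣-refl 2∣k))

-- Weights, principal square roots and the incidence matrix

module _ {n} (G : OrientedGraph n) where
  open OrientedGraph G

  entry-src-tgt : ∀ e → entry G (src e) (tgt e) ≈ weight e
  entry-src-tgt e with any? (λ f → (src f ≟ src e) ×-dec (tgt f ≟ tgt e))
  ... | yes (f , p , q) with refl ← no-parallel f e p q = ≈-refl {weight e}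
  ... | no ∄ = ⊥-elim (∄ (e , refl , refl))

  entry-tgt-src : ∀ e → entry G (tgt e) (src e) ≈ conj (weight e)
  entry-tgt-src e with any? (λ f → (src f ≟ tgt e) ×-dec (tgt f ≟ src e))
  ... | yes (f , p , q) = ⊥-elim (no-antiparallel f e p q)
  ... | no _ with any? (λ f → (src f ≟ src e) ×-dec (tgt f ≟ tgt e))
  ...   | yes (f , p , q) with refl ← no-parallel f e p q = ≈-refl {conj (weight e)}
  ...   | no ∄ = ⊥-elim (∄ (e , refl , refl))

-- If Re s = 0, then w = s² = -(Im s)² is real and not positive, hence zero or negative, and both
-- are excluded.
principalSqrt-pos : ∀ {w s} → ¬ (w ≈ 0ℂ) → ¬ (w ∈ℝ⁻) → IsPrincipalSqrt w s → 0ᴿ <ᴿ Re s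
principalSqrt-pos _ _ (_ , inj₁ pos) = pos
principalSqrt-pos {w} {s@(a +i b)} w≉0 w∉ℝ⁻ ((re , im) , inj₂ (a≈0 , _)) = ⊥-elim (w≉0 (Re≈0 , Im≈0))
  where
  -bb≈Re : -ᴿ (b *ᴿ b) ≈ᴿ Re w
  -bb≈Re = null-resp
    (λ n → solve 3 (λ a b w → (a :* a :- b :* b :- w) :+ (:- (a :* (a :- con 0ℚ))) := (:- (b :* b)) :- w) refl
      (seq a n) (seq b n) (seq (Re w) n))
    (null-+ re (null-neg (null-* a a≈0)))
  Im≈0 : Im w ≈ᴿ 0ᴿ
  Im≈0 = null-resp
    (λ n → solve 3 (λ a b w → (:- ((a :* b :+ b :* a) :- w)) :+ (b :* (a :- con 0ℚ) :+ b :* (a :- con 0ℚ)) := w :- con 0ℚ) refl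
      (seq a n) (seq b n) (seq (Im w) n))
    (null-+ (null-neg im) (null-+ (null-* b a≈0) (null-* b a≈0)))
  Re≈0 : Re w ≈ᴿ 0ᴿ
  Re≈0 = ≮≯⇒≈0 {Re w}
    (λ 0<Re → pos⇒≉0 { -ᴿ (b *ᴿ b) +ᴿ b *ᴿ b}
      (pos-+-square { -ᴿ (b *ᴿ b)} b (pos-resp {Re w} { -ᴿ (b *ᴿ b)} (≈ᴿ-sym { -ᴿ (b *ᴿ b)} {Re w} -bb≈Re) 0<Re))
      (≗⇒≈ᴿ { -ᴿ (b *ᴿ b) +ᴿ b *ᴿ b} {0ᴿ} λ n → ℚₚ.+-inverseˡ (seq b n ℚ.* seq b n)))
    (λ 0<-Re → w∉ℝ⁻ (Im≈0 , pos-neg⇒neg {Re w} 0<-Re))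

-- Both `t` and `conj s` are square roots of `conj w`, and their sum has positive real part, so they
-- are not opposite. On the negative real axis, where Re s = 0, the identity fails.
principalSqrt-conj : ∀ {w s t} → IsPrincipalSqrt w s → 0ᴿ <ᴿ Re s → IsPrincipalSqrt (conj w) t → t ≈ conj s
principalSqrt-conj {w} {s} {t} (ss≈w , _) 0<Re (tt≈w̄ , part) = square-injective {t} {conj s}
  (begin
    t * t            ≈⟨ tt≈w̄ ⟩
    conj w           ≈⟨ conj-cong {s * s} {w} ss≈w ⟨
    conj (s * s)     ≈⟨ conj-* s s ⟩
    conj s * conj s  ∎)
  (λ (eq , _) → Re-t+s≉0 part eq)
  where
  Re-t+s≉0 : (0ᴿ <ᴿ Re t) ⊎ ((Re t ≈ᴿ 0ᴿ) × (0ᴿ ≤ᴿ Im t)) → ¬ (Re t +ᴿ Re s ≈ᴿ 0ᴿ)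
  Re-t+s≉0 (inj₁ 0<Ret) eq = pos⇒≉0 {Re t +ᴿ Re s} (pos-+ {Re t} {Re s} 0<Ret 0<Re) eq
  Re-t+s≉0 (inj₂ (Ret≈0 , _)) eq = pos⇒≉0 {Re s} 0<Re (null-resp
    (λ n → solve 2 (λ t s → ((t :+ s) :- con 0ℚ) :+ (:- (t :- con 0ℚ)) := s :- con 0ℚ) refl (seq (Re t) n) (seq (Re s) n))
    (null-+ eq (null-neg Ret≈0)))

module Incidence {n} (G : OrientedGraph n) (connected : WeaklyConnected G)
  (weight∉ℝ⁻ : ∀ e → ¬ (OrientedGraph.weight G e ∈ℝ⁻))
  (N : Matrix n (OrientedGraph.m G)) (isIncidence : IsSignlessIncidence G N) where

  open OrientedGraph G
  open IsSignlessIncidence isIncidence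

  -- The root is read off the matrix itself, so no square root has to be constructed.
  σ : Fin m → ℂ
  σ e = N (src e) e

  Re-σ-pos : ∀ e → 0ᴿ <ᴿ Re (σ e)
  Re-σ-pos e = principalSqrt-pos {weight e} {σ e} (weight≉0 e) (weight∉ℝ⁻ e) (at-src e)

  σ≉0 : ∀ e → ¬ (σ e ≈ 0ℂ)
  σ≉0 e (re , _) = pos⇒≉0 {Re (σ e)} (Re-σ-pos e) re

  N-tgt : ∀ e → N (tgt e) e ≈ conj (σ e)
  N-tgt e = principalSqrt-conj {weight e} {σ e} {N (tgt e) e} (at-src e) (Re-σ-pos e) (at-tgt e)

  σσ≈weight : ∀ e → σ e * σ e ≈ weight e
  σσ≈weight e = proj₁ (at-src e)

  b : Fin n → Fin n → ℂ
  b i j = - entry G i j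

  b-src-tgt : ∀ e → b (src e) (tgt e) ≈ - (σ e * σ e)
  b-src-tgt e = begin
    - entry G (src e) (tgt e)  ≈⟨ -‿cong {entry G (src e) (tgt e)} {weight e} (entry-src-tgt G e) ⟩
    - weight e                 ≈⟨ -‿cong {σ e * σ e} {weight e} (σσ≈weight e) ⟨
    - (σ e * σ e)              ∎

  b-tgt-src : ∀ e → b (tgt e) (src e) ≈ - (conj (σ e) * conj (σ e))
  b-tgt-src e = begin
    - entry G (tgt e) (src e)  ≈⟨ -‿cong {entry G (tgt e) (src e)} {conj (weight e)} (entry-tgt-src G e) ⟩
    - conj (weight e)          ≈⟨ -‿cong {conj (σ e * σ e)} {conj (weight e)} (conj-cong {σ e * σ e} {weight e} (σσ≈weight e)) ⟨
    - conj (σ e * σ e)         ≈⟨ -‿cong {conj (σ e * σ e)} {conj (σ e) * conj (σ e)} (conj-* (σ e) (σ e)) ⟩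
    - (conj (σ e) * conj (σ e)) ∎

  open Gains G σ σ≉0 b b-src-tgt b-tgt-src public

  κ≈±wt : ∀ {i j} (γ : Walk G i j) → κ γ ≈ (- 1ℂ) ^ length G γ * wt G γ
  κ≈±wt [] = ≈-sym {1ℂ * 1ℂ} {1ℂ} (*-identityˡ 1ℂ)
  κ≈±wt (_∷_ {i} {j} A γ) =
    signed-step (entry G i j) {wt G γ} {(- 1ℂ) ^ length G γ} {κ γ} (κ≈±wt γ)

  κ≈wt : ∀ {i j} (γ : Walk G i j) → 2 ∣ length G γ → κ γ ≈ wt G γ
  κ≈wt γ even = unscale {κ γ} {(- 1ℂ) ^ length G γ} {wt G γ} (κ≈±wt γ) (even-sign (length G γ) even)

  κ≈-wt : ∀ {i j} (γ : Walk G i j) → ¬ (2 ∣ length G γ) → κ γ ≈ - wt G γ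
  κ≈-wt γ odd = unscale-neg {κ γ} {(- 1ℂ) ^ length G γ} {wt G γ} (κ≈±wt γ) (odd-sign (length G γ) odd)

  -- `_<ᴿ_` demands an explicit rational margin; it comes from `Re-σ-pos`, as ∣σ∣² is at least (Re
  -- σ)².
  ρ∈ℝ⁺ : ∀ {i j} (γ : Walk G i j) → ρ γ ∈ℝ⁺
  ρ∈ℝ⁺ [] = ≈ᴿ-refl {0ᴿ} , 0<1ᴿ
  ρ∈ℝ⁺ ((e , _) ∷ γ) = ∈ℝ⁺-* {∥ e ∥} {ρ γ}
    (∈ℝ⁺-resp {real ∣ σ e ∣²} {∥ e ∥} (≈-sym {∥ e ∥} {real ∣ σ e ∣²} (z*conj (σ e)))
      (≈ᴿ-refl {0ᴿ} , pos-+-square {Re (σ e) *ᴿ Re (σ e)} (Im (σ e))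
        (pos-* {Re (σ e)} {Re (σ e)} (Re-σ-pos e) (Re-σ-pos e))))
    (ρ∈ℝ⁺ γ)

  -- A real `κ γ` equals its conjugate, so κ² = ρ²; both are positive and cannot be opposite.
  κ∈ℝ⁺⇒κ≈ρ : ∀ {i j} (γ : Walk G i j) → κ γ ∈ℝ⁺ → κ γ ≈ ρ γ
  κ∈ℝ⁺⇒κ≈ρ γ κ∈ℝ⁺ = square-injective {κ γ} {ρ γ}
    (begin
      κ γ * κ γ         ≈⟨ *-congˡ {κ γ} {conj (κ γ)} {κ γ} (∈ℝ⁺⇒conj≈ {κ γ} κ∈ℝ⁺) ⟨
      κ γ * conj (κ γ)  ≈⟨ κ*conj γ ⟩
      ρ γ * ρ γ         ∎)
    (λ (re , _) → pos⇒≉0 {Re (κ γ) +ᴿ Re (ρ γ)} (pos-+ {Re (κ γ)} {Re (ρ γ)} (proj₂ κ∈ℝ⁺) (proj₂ (ρ∈ℝ⁺ γ))) re)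

  -- The weight and `κ γ` differ only by a sign, which disappears from the product with the
  -- conjugate; hence r² = ρ².
  modulus≈ρ : ∀ {i j} (γ : Walk G i j) {r} → IsModulus (wt G γ) r → real r ≈ ρ γ
  modulus≈ρ γ {r} (0≤r , rr≈) = square-injective {real r} {ρ γ}
    (begin
      real r * real r         ≈⟨ ≗⇒≈ {real r * real r} {real (r *ᴿ r)}
        (λ n → solve 1 (λ a → a :* a :- con 0ℚ :* con 0ℚ := a :* a) refl (seq r n))
        (λ n → solve 1 (λ a → a :* con 0ℚ :+ con 0ℚ :* a := con 0ℚ) refl (seq r n)) ⟩
      real (r *ᴿ r)           ≈⟨ rr≈ , ≈ᴿ-refl {0ᴿ} ⟩
      real ∣ wt G γ ∣²        ≈⟨ z*conj (wt G γ) ⟨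
      wt G γ * conj (wt G γ)  ≈⟨ wt*conj (2 ∣? length G γ) ⟩
      κ γ * conj (κ γ)        ≈⟨ κ*conj γ ⟩
      ρ γ * ρ γ               ∎)
    -- If r + ρ were zero, -r would equal the positive ρ, making r negative; `0ᴿ ≤ᴿ r` is exactly
    -- the refutation of that.
    (λ (re , _) → 0≤r (pos-neg⇒neg {r} (pos-resp {Re (ρ γ)} { -ᴿ r}
      (null-resp (λ n → solve 2 (λ a b → (a :+ b) :- con 0ℚ := b :- (:- a)) refl (seq r n) (seq (Re (ρ γ)) n)) re)
      (proj₂ (ρ∈ℝ⁺ γ)))))
    where
    w = wt G γ
    wt*conj : Dec (2 ∣ length G γ) → w * conj w ≈ κ γ * conj (κ γ)
    wt*conj (yes even) = ≈-sym {κ γ * conj (κ γ)} {w * conj w}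
      (*-cong {κ γ} {w} {conj (κ γ)} {conj w} (κ≈wt γ even) (conj-cong {κ γ} {w} (κ≈wt γ even)))
    wt*conj (no odd) = ≈-trans {w * conj w} { - w * conj (- w)} {κ γ * conj (κ γ)}
      (≈-sym { - w * conj (- w)} {w * conj w} (-x*-y w (conj w)))
      (≈-sym {κ γ * conj (κ γ)} { - w * conj (- w)}
        (*-cong {κ γ} { - w} {conj (κ γ)} {conj (- w)} (κ≈-wt γ odd) (conj-cong {κ γ} { - w} (κ≈-wt γ odd))))

  open Projection connected N (λ e → ≈-refl {σ e}) N-tgt elsewhere public

identity-diagonal : ∀ {n} (i : Fin n) → identity n i i ≈ 1ℂ
identity-diagonal i with i ≟ i
... | yes _ = ≈-refl {1ℂ}
... | no i≢i = ⊥-elim (i≢i refl)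

identity-off : ∀ {n} {i j : Fin n} → i ≢ j → identity n i j ≈ 0ℂ
identity-off {i = i} {j} i≢j with i ≟ j
... | yes i≡j = ⊥-elim (i≢j i≡j)
... | no _ = ≈-refl {0ℂ}

-- From weights of cycles to balance

theorem2p7 : (n : ℕ) .{{_ : NonZero n}} → 2 ≤ n →
    (G : OrientedGraph n) → WeaklyConnected G →
    (∀ e → ¬ (OrientedGraph.weight G e ∈ℝ⁻)) →
    (N : Matrix n (OrientedGraph.m G)) → IsSignlessIncidence G N →
    (N⁺ : Matrix (OrientedGraph.m G) n) → IsMoorePenroseInverse N N⁺ →
    ((∃[ i ] Σ (Walk G i i) λ C → IsEvenCycle G C × ¬ (wt G C ∈ℝ⁺))
    ⊎ (∃[ i ] Σ (Walk G i i) λ C → IsOddCycle G C × ¬ (wt G C ∈ℝ⁻)) →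
    N *ᴹ N⁺ ≈ᴹ identity n)
    ×
    (IsOrientedTree G
    ⊎ ((∀ {i} (C : Walk G i i) → IsEvenCycle G C → wt G C ∈ℝ⁺)
    × (∀ {i} (C : Walk G i i) → IsOddCycle G C → wt G C ∈ℝ⁻)) →
    (S : Matrix n n) → IsSignedEquiweight G S →
    N *ᴹ N⁺ ≈ᴹ identity n -ᴹ reciprocal n ·ᴹ S)
theorem2p7 n _ G connected weight∉ℝ⁻ N isIncidence N⁺ isMP = partA , partB
  where
  open IsMoorePenroseInverse isMP
  open Incidence G connected weight∉ℝ⁻ N isIncidence

  partA : (∃[ i ] Σ (Walk G i i) λ C → IsEvenCycle G C × ¬ (wt G C ∈ℝ⁺))
    ⊎ (∃[ i ] Σ (Walk G i i) λ C → IsOddCycle G C × ¬ (wt G C ∈ℝ⁻)) →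
    N *ᴹ N⁺ ≈ᴹ identity n
  partA h = unbalanced⇒P≈δ N⁺ AXA≈A AX-hermitian (identity n) identity-diagonal identity-off
    (proj₁ (proj₂ (cycle h))) (proj₂ (proj₂ (cycle h)))
    where
    cycle : (∃[ i ] Σ (Walk G i i) λ C → IsEvenCycle G C × ¬ (wt G C ∈ℝ⁺))
      ⊎ (∃[ i ] Σ (Walk G i i) λ C → IsOddCycle G C × ¬ (wt G C ∈ℝ⁻)) →
      ∃[ i ] Σ (Walk G i i) λ C → ¬ (κ C ≈ ρ C)
    -- If κ C = ρ C, then κ C is positive; it equals wt C for even length and -wt C for odd length,
    -- contradicting the assumption on the cycle.
    cycle (inj₁ (i , C , (_ , even) , ∉ℝ⁺)) = i , C , λ κ≈ρ → ∉ℝ⁺ (∈ℝ⁺-resp {κ C} {wt G C} (κ≈wt C even)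
      (∈ℝ⁺-resp {ρ C} {κ C} (≈-sym {κ C} {ρ C} κ≈ρ) (ρ∈ℝ⁺ C)))
    cycle (inj₂ (i , C , (_ , odd) , ∉ℝ⁻)) = i , C , λ κ≈ρ → ∉ℝ⁻ (-∈ℝ⁺⇒∈ℝ⁻ {wt G C} (∈ℝ⁺-resp {κ C} { - wt G C} (κ≈-wt C odd)
      (∈ℝ⁺-resp {ρ C} {κ C} (≈-sym {κ C} {ρ C} κ≈ρ) (ρ∈ℝ⁺ C))))

  partB : IsOrientedTree G
    ⊎ ((∀ {i} (C : Walk G i i) → IsEvenCycle G C → wt G C ∈ℝ⁺)
    × (∀ {i} (C : Walk G i i) → IsOddCycle G C → wt G C ∈ℝ⁻)) →
    (S : Matrix n n) → IsSignedEquiweight G S →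
    N *ᴹ N⁺ ≈ᴹ identity n -ᴹ reciprocal n ·ᴹ S
  partB h S isS = balanced⇒P≈δ-S/n N⁺ AXA≈A AX-hermitian (identity n) identity-diagonal identity-off
    (cycles⇒balanced (cycle h)) S walk S-def (reciprocal n) (reciprocal-inverse n)
    where
    cycle : IsOrientedTree G
      ⊎ ((∀ {i} (C : Walk G i i) → IsEvenCycle G C → wt G C ∈ℝ⁺)
      × (∀ {i} (C : Walk G i i) → IsOddCycle G C → wt G C ∈ℝ⁻)) →
      ∀ {i} (C : Walk G i i) → IsCycle G C → κ C ≈ ρ C
    cycle (inj₁ (_ , acyclic)) C isCycle = ⊥-elim (acyclic C isCycle)
    cycle (inj₂ (even⁺ , odd⁻)) C isCycle = κ∈ℝ⁺⇒κ≈ρ C (by-parity (2 ∣? length G C))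
      where
      by-parity : Dec (2 ∣ length G C) → κ C ∈ℝ⁺
      by-parity (yes even) = ∈ℝ⁺-resp {wt G C} {κ C} (≈-sym {κ C} {wt G C} (κ≈wt C even))
        (even⁺ C (isCycle , even))
      by-parity (no odd) = ∈ℝ⁺-resp { - wt G C} {κ C} (≈-sym {κ C} { - wt G C} (κ≈-wt C odd))
        (∈ℝ⁻⇒-∈ℝ⁺ {wt G C} (odd⁻ C (isCycle , odd)))
    walk : ∀ i j → Walk G i j
    walk i j = proj₁ (proj₂ (isS i j))
    S-def : ∀ i j → S i j * ρ (walk i j) ≈ κ (walk i j)
    S-def i j = from-quotient (isS i j)
      where
      from-quotient : ((d , γ , r , _) : ∃[ d ] Σ (Walk G i j) λ γ → ∃[ r ]
          (IsDistance G i j d × length G γ ≡ d × IsModulus (wt G γ) r ×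
           IsQuotient ((- 1ℂ) ^ d * wt G γ) (real r) (S i j))) →
        S i j * ρ γ ≈ κ γ
      -- Matching `refl` identifies d with the length of `γ`, so the sign in `S` is the one in
      -- `κ≈±wt`.
      from-quotient (_ , γ , r , _ , refl , isModulus , (_ , Sr≈)) = begin
        S i j * ρ γ                    ≈⟨ *-congˡ {S i j} {real r} {ρ γ} (modulus≈ρ γ {r} isModulus) ⟨
        S i j * real r                 ≈⟨ Sr≈ ⟩
        (- 1ℂ) ^ length G γ * wt G γ   ≈⟨ κ≈±wt γ ⟨
        κ γ                            ∎
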